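{- Let $G$ be an $r$-regular graph and let $0\leq\alpha\leq 1$. (i) Suppose $G$ contains $t$ pairwise vertex-disjoint cliques. Then $S_k(A_{\alpha}(G))\geq \alpha kr+(1-\alpha)(r-k+1)$ for $1\leq k \leq t+1$. (ii) Suppose $G$ contains $c$ pairwise vertex-disjoint induced cycles $C_{g_1}, C_{g_2}, \ldots, C_{g_c}$, each of even length, with lengths $g_1\geq g_2\geq \cdots \geq g_c$. Then $$S_k(A_{\alpha}(G))\geq (\alpha k+1-\alpha)r+2(1-\alpha)\sum_{i=1}^{k-1}\left(1-\frac{4}{g_{i}}\right)$$ for $1\leq k \leq c+1$.
   Context: All graphs are simple and undirected. $A_{\alpha}(G)=\alpha D(G)+(1-\alpha)A(G)$, where $A(G)$ is the adjacency matrix and $D(G)$ the diagonal degree matrix. For a real symmetric matrix $M$ with eigenvalues $\lambda_1(M)\geq\cdots\geq\lambda_n(M)$, $S_k(M)=\sum_{i=1}^k\lambda_i(M)$. A clique of $G$ is a maximal complete subgraph of $G$. $C_g$ denotes a cycle of length $g$. -}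

module Defs where

open import Algebra.Apartness.Bundles using (HeytingCommutativeRing; HeytingField)
open import Algebra.Bundles using (CommutativeRing)
import Algebra.Definitions.RawMonoid
open import Data.Bool.Base using (if_then_else_)
open import Data.Fin.Base as Fin using (Fin; inject≤; toℕ)
open import Data.Fin.Properties using (_≟_)
open import Data.Fin.Subset using (Subset; _∈_; _⊆_; _∩_; Empty; ∣_∣)
open import Data.Nat.Base as ℕ using (ℕ; zero; suc)
open import Data.Nat.Divisibility.Core using (_∣_)
open import Data.Product.Base using (∃-syntax; _×_; _,_; proj₁; proj₂)
open import Data.Sum.Base using (_⊎_; inj₂)
open import Data.Vec.Base using (tabulate)
open import Data.Vec.Functional using (Vector)
open import Function.Bundles using (_⇔_; Equivalence)
open import Function.Definitions using (Injective)
open import Level using (Level; _⊔_; 0ℓ) renaming (suc to lsuc)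
open import Relation.Binary.Core using (Rel)
open import Relation.Binary.Definitions using (Symmetric; Decidable)
open import Relation.Binary.PropositionalEquality.Core using (_≡_; _≢_)
open import Relation.Binary.Structures using (IsStrictPartialOrder)
open import Relation.Nullary.Decidable.Core using (does)
open import Relation.Nullary.Negation.Core using (¬_)

-- The real numbers, axiomatised as an Archimedean, Cauchy-complete ordered
-- field.  Classically these axioms determine ℝ up to isomorphism, and the
-- apartness and order axioms are equivalent to having a linearly ordered field.
-- They are phrased so that they also hold of constructive real numbers: order
-- and equality are not assumed decidable, and x ≤ y means ¬ (y < x).
record RealNumbers (c ℓ₁ ℓ₂ : Level) : Set (lsuc (c ⊔ ℓ₁ ⊔ ℓ₂)) where
  infix 4 _<_ _≤_
  field
    heytingField : HeytingField c ℓ₁ ℓ₂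

  open HeytingField heytingField public

  commutativeRing : CommutativeRing c ℓ₁
  commutativeRing = HeytingCommutativeRing.commutativeRing heytingCommutativeRing

  open CommutativeRing commutativeRing public using (semiring; +-rawMonoid)
  open Algebra.Definitions.RawMonoid +-rawMonoid public
    using (sum) renaming (_×_ to _·_)

  fromℕ : ℕ → Carrier
  fromℕ n = n · 1#

  field
    _<_                  : Rel Carrier ℓ₂
    isStrictPartialOrder : IsStrictPartialOrder _≈_ _<_
    #⇔<⊎>                : ∀ {x y} → x # y ⇔ (x < y ⊎ y < x)
    0<1                  : 0# < 1#
    +-monoˡ-<            : ∀ z {x y} → x < y → x + z < y + z
    *-pos                : ∀ {x y} → 0# < x → 0# < y → 0# < x * y
    archimedean          : ∀ x → ∃[ n ] x < fromℕ n

  -- Both conditions bound an absolute value: swapping m and n in the first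
  -- gives the other inequality.
  IsCauchy : (ℕ → Carrier) → Set (c ⊔ ℓ₂)
  IsCauchy s = ∀ {ε} → 0# < ε →
    ∃[ N ] (∀ m n → N ℕ.≤ m → N ℕ.≤ n → s m < s n + ε)

  _ConvergesTo_ : (ℕ → Carrier) → Carrier → Set (c ⊔ ℓ₂)
  s ConvergesTo l = ∀ {ε} → 0# < ε →
    ∃[ N ] (∀ n → N ℕ.≤ n → (s n < l + ε) × (l < s n + ε))

  field
    complete : ∀ s → IsCauchy s → ∃[ l ] s ConvergesTo l

  open IsStrictPartialOrder isStrictPartialOrder public
    using (<-respˡ-≈; <-respʳ-≈) renaming (irrefl to <-irrefl; trans to <-trans)

  _≤_ : Rel Carrier ℓ₂
  x ≤ y = ¬ (y < x)

  0<suc : ∀ n → 0# < fromℕ (suc n)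
  0<suc zero    = <-respʳ-≈ (sym (+-identityʳ 1#)) 0<1
  0<suc (suc n) = <-trans (0<suc n)
    (<-respˡ-≈ (+-identityˡ _) (+-monoˡ-< (fromℕ (suc n)) 0<1))

  -- Division by a natural number, with the convention x /ℕ 0 ≈ 0; it is only
  -- used for cycle lengths, which are at least 3.  #⇒invertible inverts
  -- fromℕ (suc n) - 0#.
  recip : ℕ → Carrier
  recip zero    = 0#
  recip (suc n) = proj₁ (#⇒invertible (Equivalence.from #⇔<⊎> (inj₂ (0<suc n))))

  infixl 7 _/ℕ_
  _/ℕ_ : Carrier → ℕ → Carrier
  x /ℕ n = x * recip n

record Graph (n : ℕ) : Set₁ where
  infix 4 _~_ _~?_
  field
    _~_      : Rel (Fin n) 0ℓ
    _~?_     : Decidable _~_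
    ~-sym    : Symmetric _~_
    ~-irrefl : ∀ {u} → ¬ (u ~ u)

  neighbours : Fin n → Subset n
  neighbours u = tabulate (λ v → does (u ~? v))

  degree : Fin n → ℕ
  degree u = ∣ neighbours u ∣

module _ {n : ℕ} (G : Graph n) where
  open Graph G

  Regular : ℕ → Set
  Regular r = ∀ u → degree u ≡ r

  Complete : Subset n → Set
  Complete K = ∀ {u v} → u ∈ K → v ∈ K → u ≢ v → u ~ v

  IsClique : Subset n → Set
  IsClique K = Complete K × (∀ L → Complete L → K ⊆ L → L ⊆ K)

  record DisjointCliques (t : ℕ) : Set where
    field
      clique   : Fin t → Subset n
      isClique : ∀ i → IsClique (clique i)
      disjoint : ∀ {i j} → i ≢ j → Empty (clique i ∩ clique j)

-- Adjacency in the cycle 0 – 1 – ⋯ – (g - 1) – 0.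
CycleStep : ∀ {g} → Rel (Fin g) 0ℓ
CycleStep {g} a b =
  (suc (toℕ a) ≡ toℕ b) ⊎ (suc (toℕ a) ≡ g × toℕ b ≡ 0)

CycleAdj : ∀ {g} → Rel (Fin g) 0ℓ
CycleAdj a b = CycleStep a b ⊎ CycleStep b a

module _ {n : ℕ} (G : Graph n) where
  open Graph G

  record InducedCycle (g : ℕ) : Set where
    field
      3≤g       : 3 ℕ.≤ g
      vertex    : Fin g → Fin n
      injective : Injective _≡_ _≡_ vertex
      induced   : ∀ a b → vertex a ~ vertex b ⇔ CycleAdj a b

  record DisjointEvenInducedCycles {m : ℕ} (g : Fin m → ℕ) : Set where
    field
      even       : ∀ i → 2 ∣ g i
      decreasing : ∀ {i j} → i Fin.≤ j → g j ℕ.≤ g i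
      cycle      : ∀ i → InducedCycle (g i)
      disjoint   : ∀ {i j} → i ≢ j → ∀ a b →
                   InducedCycle.vertex (cycle i) a ≢ InducedCycle.vertex (cycle j) b

module Spectral {c ℓ₁ ℓ₂} (ℝ : RealNumbers c ℓ₁ ℓ₂) where
  open RealNumbers ℝ public

  Matrix : ℕ → Set c
  Matrix n = Fin n → Fin n → Carrier

  module _ {n : ℕ} where

    infixr 7 _*ᵥ_
    _*ᵥ_ : Matrix n → Vector Carrier n → Vector Carrier n
    (M *ᵥ v) i = sum (λ j → M i j * v j)

    LinearlyIndependent : ∀ {m} → (Fin m → Vector Carrier n) → Set (c ⊔ ℓ₁)
    LinearlyIndependent {m} v = (a : Vector Carrier m) →
      (∀ i → sum (λ j → a j * v j i) ≈ 0#) → ∀ j → a j ≈ 0#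

    -- The eigenvalues λ₁ ≥ ⋯ ≥ λₙ of M.  Since the n eigenvectors form a basis,
    -- each eigenvalue is listed as often as the dimension of its eigenspace, so
    -- the list is unique; for a real symmetric M it exists (spectral theorem).
    record Eigenvalues (M : Matrix n) : Set (c ⊔ ℓ₁ ⊔ ℓ₂) where
      field
        eigenvalue  : Fin n → Carrier
        decreasing  : ∀ {i j} → i Fin.≤ j → eigenvalue j ≤ eigenvalue i
        eigenvector : Fin n → Vector Carrier n
        isEigen     : ∀ i j → (M *ᵥ eigenvector i) j ≈ eigenvalue i * eigenvector i j
        independent : LinearlyIndependent eigenvector

    S : {M : Matrix n} → Eigenvalues M → ∀ k → k ℕ.≤ n → Carrier
    S Λ k k≤n = sum {k} (λ i → Eigenvalues.eigenvalue Λ (inject≤ i k≤n))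

    module _ (G : Graph n) where
      open Graph G

      adjacencyMatrix : Matrix n
      adjacencyMatrix i j = if does (i ~? j) then 1# else 0#

      degreeMatrix : Matrix n
      degreeMatrix i j = if does (i ≟ j) then fromℕ (degree i) else 0#

      A[_] : Carrier → Matrix n
      A[ α ] i j = α * degreeMatrix i j + (1# - α) * adjacencyMatrix i j

{-# OPTIONS --safe #-}
-- For an r-regular graph A_α = α r I + (1 - α) A, so by Ky Fan's principle S_k is
-- at least the sum over k orthogonal test vectors x of α r + (1 - α) ⟨x, A x⟩ / ⟨x, x⟩.
-- The all-ones vector contributes r.  The others are supported on the disjoint
-- subgraphs and orthogonal to it: e_u - e_v for an edge uv of a clique (quotient - 1),
-- and + 1 on one half, - 1 on the other half of an even cycle (quotient 2 - 8/g).
-- When r = 0 the cliques have no edge, and standard basis vectors are used instead.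
--
-- Ky Fan's principle needs an orthogonal eigenbasis, obtained by Gram–Schmidt from
-- the given independent eigenvectors.  That construction divides by norms known
-- only to be nonzero; this is harmless because ≤ is a negation, so the basis is
-- needed only up to double negation.
module Submission where

open import Defs
import Algebra.Apartness.Properties.HeytingCommutativeRing as HeytingProperties
open import Algebra.Bundles using (CommutativeRing)
import Algebra.Properties.AbelianGroup as AbelianGroupProperties
import Algebra.Properties.Ring as RingProperties
import Algebra.Properties.Semiring.Mult.TCOptimised as Mult
import Algebra.Properties.Semiring.Sum as SumProperties
import Algebra.Solver.Ring
open import Algebra.Solver.Ring.AlmostCommutativeRing
  using (fromCommutativeRing; _-Raw-AlmostCommutative⟶_)
open import Data.Bool.Base using (Bool; true; false; if_then_else_)
open import Data.Empty using (⊥)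
open import Data.Fin.Base as Fin using (Fin; zero; suc; toℕ; inject≤; fromℕ<)
import Data.Fin.Properties as Fin
open import Data.Fin.Subset using (Subset; _∈_; _⊆_; _∪_; ∣_∣; ⁅_⁆; Nonempty)
import Data.Fin.Subset.Properties as Subset
open import Data.Integer.Base as ℤ using (ℤ; +_; -[1+_])
import Data.Integer.Properties as ℤ
open import Data.Maybe.Base using (Maybe; just; nothing)
open import Data.Nat.Base as ℕ using (ℕ; zero; suc; _∸_)
open import Data.Nat.Divisibility.Core using (_∣_; divides)
import Data.Nat.Properties as ℕ
open import Data.Nat.Properties using (∸-monoˡ-≤)
open import Data.Product.Base using (∃-syntax; Σ-syntax; _×_; _,_; proj₁; proj₂)
open import Data.Sum.Base using (_⊎_; inj₁; inj₂; [_,_]′)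
open import Data.Unit.Base using (tt)
open import Data.Vec.Base using (tabulate)
open import Data.Vec.Functional using (Vector; _∷_)
import Data.Vec.Properties as Vec
open import Function.Base using (_∘_)
open import Function.Bundles using (Equivalence)
open import Function.Definitions using (Injective)
open import Level using (_⊔_)
open import Relation.Binary.Definitions using (tri<; tri≈; tri>)
open import Relation.Binary.PropositionalEquality.Core as ≡ using (_≡_; _≢_)
import Relation.Binary.Reasoning.Setoid as ≈-Reasoning
open import Relation.Nullary.Decidable.Core using (yes; no; does; _×-dec_)
open import Relation.Nullary.Negation using (¬_; contradiction)

-- Ky Fan's principle itself is proved by expanding the test vectors in the eigenbasis: the sum of
-- their quotients becomes a weighted sum of eigenvalues, with weights in [0,1] adding up to k. Only
-- the diagonal quotients enter, so edges running between different cliques or cycles do no harm: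
-- disjoint supports already give orthogonality. Orthogonality to the all-ones vector means that the
-- entries add up to 0; that vector counts as one more test vector, which is why k may exceed the
-- number of subgraphs by one. A vector of signs with sum 0 needs a cycle of even length and changes
-- sign along at least two edges; two blocks attain this minimum. Each change costs 2 in the sum
-- over the edges, whence g - 4 in place of g. For cliques, maximality is what produces an edge:
-- when the degree is positive, a single vertex is not maximal.

-- Equality in R is not decidable, so the ring solver takes its coefficients in ℤ.
module IntegerCoefficients {c ℓ} (R : CommutativeRing c ℓ) where
  open CommutativeRing R
  open AbelianGroupProperties +-abelianGroup using (⁻¹-∙-comm; ε⁻¹≈ε; ⁻¹-involutive)
  open RingProperties ring using (-‿distribˡ-*; -‿distribʳ-*)
  open Mult semiring using (×-homo-+; ×1-homo-*; 1+×) renaming (_×_ to _×′_)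
  open ≈-Reasoning setoid

  -- The multiple `×′` sends 1 to `1#` and 2 to `1# + 1#` by computation. Hence `1-homo` is `refl`,
  -- and `con (+ 2)` in later solver calls is literally a sum of two ones.
  ⟦_⟧ℤ : ℤ → Carrier
  ⟦ + n ⟧ℤ      = n ×′ 1#
  ⟦ -[1+ n ] ⟧ℤ = - (suc n ×′ 1#)

  -- Integer addition of opposite signs unfolds to `⊖`. Inserting 1 - 1 lets the induction peel a
  -- successor off both arguments.
  ⟦⊖⟧ : ∀ m n → ⟦ m ℤ.⊖ n ⟧ℤ ≈ m ×′ 1# - n ×′ 1#
  ⟦⊖⟧ m zero = sym (trans (+-congˡ ε⁻¹≈ε) (+-identityʳ _))
  ⟦⊖⟧ zero (suc n) = sym (+-identityˡ _)
  ⟦⊖⟧ (suc m) (suc n) = begin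
    ⟦ suc m ℤ.⊖ suc n ⟧ℤ                    ≡⟨ ≡.cong ⟦_⟧ℤ (ℤ.[1+m]⊖[1+n]≡m⊖n m n) ⟩
    ⟦ m ℤ.⊖ n ⟧ℤ                            ≈⟨ ⟦⊖⟧ m n ⟩
    m ×′ 1# - n ×′ 1#                       ≈⟨ +-congʳ (sym (+-identityˡ _)) ⟩
    0# + m ×′ 1# - n ×′ 1#                  ≈⟨ +-congʳ (+-congʳ (sym (-‿inverseʳ 1#))) ⟩
    1# - 1# + m ×′ 1# - n ×′ 1#             ≈⟨ +-congʳ (trans (+-assoc _ _ _) (trans (+-congˡ (+-comm _ _)) (sym (+-assoc _ _ _)))) ⟩
    1# + m ×′ 1# - 1# - n ×′ 1#             ≈⟨ +-assoc _ _ _ ⟩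
    1# + m ×′ 1# + (- 1# - n ×′ 1#)         ≈⟨ +-congˡ (⁻¹-∙-comm 1# (n ×′ 1#)) ⟩
    1# + m ×′ 1# - (1# + n ×′ 1#)           ≈⟨ +-cong (1+× m 1#) (-‿cong (1+× n 1#)) ⟨
    suc m ×′ 1# - suc n ×′ 1#               ∎

  +-homo : ∀ i j → ⟦ i ℤ.+ j ⟧ℤ ≈ ⟦ i ⟧ℤ + ⟦ j ⟧ℤ
  +-homo (+ m)    (+ n)    = ×-homo-+ 1# m n
  +-homo (+ m)    -[1+ n ] = ⟦⊖⟧ m (suc n)
  +-homo -[1+ m ] (+ n)    = trans (⟦⊖⟧ n (suc m)) (+-comm _ _)
  +-homo -[1+ m ] -[1+ n ] = begin
    - (suc (suc (m ℕ.+ n)) ×′ 1#)        ≡⟨ ≡.cong (λ k → - (k ×′ 1#)) (≡.cong suc (≡.sym (ℕ.+-suc m n))) ⟩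
    - ((suc m ℕ.+ suc n) ×′ 1#)          ≈⟨ -‿cong (×-homo-+ 1# (suc m) (suc n)) ⟩
    - (suc m ×′ 1# + suc n ×′ 1#)        ≈⟨ ⁻¹-∙-comm _ _ ⟨
    - (suc m ×′ 1#) - suc n ×′ 1#        ∎

  -‿homo : ∀ i → ⟦ ℤ.- i ⟧ℤ ≈ - ⟦ i ⟧ℤ
  -‿homo (+ zero)  = sym ε⁻¹≈ε
  -‿homo (+ suc n) = refl
  -‿homo -[1+ n ]  = sym (⁻¹-involutive _)

  +*-homo : ∀ m j → ⟦ + m ℤ.* j ⟧ℤ ≈ ⟦ + m ⟧ℤ * ⟦ j ⟧ℤ
  +*-homo m (+ n) = trans (reflexive (≡.cong ⟦_⟧ℤ (≡.sym (ℤ.pos-* m n)))) (×1-homo-* m n)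
  +*-homo m -[1+ n ] = begin
    ⟦ + m ℤ.* (ℤ.- + suc n) ⟧ℤ       ≡⟨ ≡.cong ⟦_⟧ℤ (ℤ.neg-distribʳ-* (+ m) (+ suc n)) ⟨
    ⟦ ℤ.- (+ m ℤ.* + suc n) ⟧ℤ       ≈⟨ -‿homo (+ m ℤ.* + suc n) ⟩
    - ⟦ + m ℤ.* + suc n ⟧ℤ           ≈⟨ -‿cong (+*-homo m (+ suc n)) ⟩
    - (⟦ + m ⟧ℤ * ⟦ + suc n ⟧ℤ)      ≈⟨ -‿distribʳ-* _ _ ⟩
    ⟦ + m ⟧ℤ * ⟦ -[1+ n ] ⟧ℤ         ∎

  *-homo : ∀ i j → ⟦ i ℤ.* j ⟧ℤ ≈ ⟦ i ⟧ℤ * ⟦ j ⟧ℤ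
  *-homo (+ m) j = +*-homo m j
  *-homo -[1+ m ] j = begin
    ⟦ (ℤ.- + suc m) ℤ.* j ⟧ℤ   ≡⟨ ≡.cong ⟦_⟧ℤ (ℤ.neg-distribˡ-* (+ suc m) j) ⟨
    ⟦ ℤ.- (+ suc m ℤ.* j) ⟧ℤ   ≈⟨ -‿homo (+ suc m ℤ.* j) ⟩
    - ⟦ + suc m ℤ.* j ⟧ℤ       ≈⟨ -‿cong (+*-homo (suc m) j) ⟩
    - (⟦ + suc m ⟧ℤ * ⟦ j ⟧ℤ)  ≈⟨ -‿distribˡ-* _ _ ⟩
    ⟦ -[1+ m ] ⟧ℤ * ⟦ j ⟧ℤ     ∎

  _≈?_ : ∀ i j → Maybe (⟦ i ⟧ℤ ≈ ⟦ j ⟧ℤ)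
  i ≈? j with i ℤ.≟ j
  ... | yes i≡j = just (reflexive (≡.cong ⟦_⟧ℤ i≡j))
  ... | no  _   = nothing

  morphism : ℤ.+-*-rawRing -Raw-AlmostCommutative⟶ fromCommutativeRing R
  morphism = record
    { ⟦_⟧    = ⟦_⟧ℤ
    ; +-homo = +-homo
    ; *-homo = *-homo
    ; -‿homo = -‿homo
    ; 0-homo = refl
    ; 1-homo = refl
    }

  open Algebra.Solver.Ring
    ℤ.+-*-rawRing (fromCommutativeRing R)
    morphism
    _≈?_ public
    using (solve; con; _:+_; _:*_; _:-_; :-_; _:=_)

-- Order arithmetic of the reals.

module RealLinearAlgebra {c ℓ₁ ℓ₂} (ℝ : RealNumbers c ℓ₁ ℓ₂) where
  open Spectral ℝ hiding (zero)
  open IntegerCoefficients commutativeRing using (solve; con; _:+_; _:*_; _:-_; :-_; _:=_)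
  open HeytingProperties heytingCommutativeRing using (1#0; x-0≈x; x#0y#0→xy#0)
  open SumProperties semiring
    using (sum-cong-≋; sum-replicate-zero; ∑-comm;
           *-distribˡ-sum; *-distribʳ-sum)
  open ≈-Reasoning setoid

  ¬#⇒≈ : ∀ {x y} → ¬ (x # y) → x ≈ y
  ¬#⇒≈ = proj₁ (tight _ _)

  <⇒≤ : ∀ {x y} → x < y → x ≤ y
  <⇒≤ x<y y<x = <-irrefl refl (<-trans x<y y<x)

  ≤-antisym : ∀ {x y} → x ≤ y → y ≤ x → x ≈ y
  ≤-antisym x≤y y≤x = ¬#⇒≈ ([ y≤x , x≤y ]′ ∘ Equivalence.to #⇔<⊎>)

  ≤-reflexive : ∀ {x y} → x ≈ y → x ≤ y
  ≤-reflexive x≈y y<x = <-irrefl (sym x≈y) y<x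

  -- Order is not decidable, but ≤ is a negation, so a case split on the sign is
  -- available whenever an inequality is to be proved.
  0≤-cases : ∀ {x} → 0# ≤ x → ¬ ¬ (0# < x ⊎ x ≈ 0#)
  0≤-cases 0≤x k = k (inj₂ (¬#⇒≈ ([ 0≤x , k ∘ inj₁ ]′ ∘ Equivalence.to #⇔<⊎>)))

  ≤-respʳ-≈ : ∀ {x y z} → y ≈ z → x ≤ y → x ≤ z
  ≤-respʳ-≈ y≈z x≤y z<x = x≤y (<-respˡ-≈ (sym y≈z) z<x)

  ≤-respˡ-≈ : ∀ {x y z} → x ≈ y → x ≤ z → y ≤ z
  ≤-respˡ-≈ x≈y x≤z z<y = x≤z (<-respʳ-≈ (sym x≈y) z<y)

  -- Cotransitivity compares `y` with the two ends of the assumed `z < x`; whichever end it is apart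
  -- from, one of the hypotheses is refuted.
  ≤-trans : ∀ {x y z} → x ≤ y → y ≤ z → x ≤ z
  ≤-trans {x} {y} {z} x≤y y≤z z<x with #-cotrans (Equivalence.from #⇔<⊎> (inj₁ z<x)) y
  ... | inj₁ z#y with Equivalence.to #⇔<⊎> z#y
  ...   | inj₁ z<y = y≤z z<y
  ...   | inj₂ y<z = x≤y (<-trans y<z z<x)
  ≤-trans {x} {y} {z} x≤y y≤z z<x | inj₂ y#x with Equivalence.to #⇔<⊎> y#x
  ...   | inj₁ y<x = x≤y y<x
  ...   | inj₂ x<y = y≤z (<-trans z<x x<y)

  +-monoˡ-≤ : ∀ z {x y} → x ≤ y → x + z ≤ y + z
  +-monoˡ-≤ z {x} {y} x≤y y+z<x+z = x≤y
    (<-respˡ-≈ (cancel y) (<-respʳ-≈ (cancel x) (+-monoˡ-< (- z) y+z<x+z)))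
    where
    cancel : ∀ w → w + z + - z ≈ w
    cancel w = solve 2 (λ w z → w :+ z :+ :- z := w) refl w z

  +-mono-≤ : ∀ {w x y z} → w ≤ x → y ≤ z → w + y ≤ x + z
  +-mono-≤ {w} {x} {y} {z} w≤x y≤z = ≤-trans (+-monoˡ-≤ y w≤x)
    (≤-respˡ-≈ (+-comm y x) (≤-respʳ-≈ (+-comm z x) (+-monoˡ-≤ x y≤z)))

  x≤y⇒0≤y-x : ∀ {x y} → x ≤ y → 0# ≤ y - x
  x≤y⇒0≤y-x {x} x≤y = ≤-respˡ-≈ (-‿inverseʳ x) (+-monoˡ-≤ (- x) x≤y)

  0≤y-x⇒x≤y : ∀ {x y} → 0# ≤ y - x → x ≤ y
  0≤y-x⇒x≤y {x} {y} 0≤y-x = ≤-respˡ-≈ (+-identityˡ x)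
    (≤-respʳ-≈ (solve 2 (λ x y → y :- x :+ x := y) refl x y) (+-monoˡ-≤ x 0≤y-x))

  *-nonneg : ∀ {x y} → 0# ≤ x → 0# ≤ y → 0# ≤ x * y
  *-nonneg {x} {y} 0≤x 0≤y xy<0 = 0≤-cases 0≤x λ
    { (inj₂ x≈0) → <-irrefl (trans (*-congʳ x≈0) (zeroˡ y)) xy<0
    ; (inj₁ 0<x) → 0≤-cases 0≤y λ
      { (inj₂ y≈0) → <-irrefl (trans (*-congˡ y≈0) (zeroʳ x)) xy<0
      ; (inj₁ 0<y) → <⇒≤ (*-pos 0<x 0<y) xy<0 } }

  *-monoˡ-≤ : ∀ {x y z} → 0# ≤ z → x ≤ y → z * x ≤ z * y
  *-monoˡ-≤ {x} {y} {z} 0≤z x≤y = 0≤y-x⇒x≤y (≤-respʳ-≈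
    (solve 3 (λ x y z → z :* (y :- x) := z :* y :- z :* x) refl x y z)
    (*-nonneg 0≤z (x≤y⇒0≤y-x x≤y)))

  -- The sign of `x` cannot be decided, but a negative square refutes both `x < 0#` (through the
  -- nonnegative `0# - x`, which has the same square) and its negation `0# ≤ x`.
  0≤x² : ∀ x → 0# ≤ x * x
  0≤x² x x²<0 = no-nonneg-root refl λ x<0 → no-nonneg-root
    (solve 1 (λ x → (con (+ 0) :- x) :* (con (+ 0) :- x) := x :* x) refl x)
    (x≤y⇒0≤y-x (<⇒≤ x<0))
    where
    no-nonneg-root : ∀ {y} → y * y ≈ x * x → ¬ (0# ≤ y)
    no-nonneg-root y²≈x² 0≤y = ≤-respʳ-≈ y²≈x² (*-nonneg 0≤y 0≤y) x²<0

  x²≈0⇒x≈0 : ∀ {x} → x * x ≈ 0# → x ≈ 0#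
  x²≈0⇒x≈0 x²≈0 = ¬#⇒≈ λ x#0 → proj₂ (tight _ _) x²≈0 (x#0y#0→xy#0 x#0 x#0)

  1≉0 : ¬ (1# ≈ 0#)
  1≉0 1≈0 = proj₂ (tight _ _) 1≈0 1#0

  #0⇒inverse : ∀ {x} → x # 0# → ∃[ y ] y * x ≈ 1#
  #0⇒inverse {x} x#0 with #⇒invertible x#0
  ... | y , inv , _ = y , trans (*-congˡ (sym (x-0≈x x))) inv

  inverse-nonneg : ∀ {x y} → y * x ≈ 1# → 0# ≤ x → 0# ≤ y
  inverse-nonneg {x} {y} yx≈1 0≤x = ≤-respʳ-≈
    (begin
      (y * y) * x  ≈⟨ *-assoc y y x ⟩
      y * (y * x)  ≈⟨ *-congˡ yx≈1 ⟩
      y * 1#       ≈⟨ *-identityʳ y ⟩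
      y            ∎)
    (*-nonneg (0≤x² y) 0≤x)

  x-y≈0⇒x≈y : ∀ {x y} → x - y ≈ 0# → x ≈ y
  x-y≈0⇒x≈y {x} {y} x-y≈0 = begin
    x          ≈⟨ solve 2 (λ x y → x := x :- y :+ y) refl x y ⟩
    x - y + y  ≈⟨ +-congʳ x-y≈0 ⟩
    0# + y     ≈⟨ +-identityˡ y ⟩
    y          ∎

  x≈y⇒x-y≈0 : ∀ {x y} → x ≈ y → x - y ≈ 0#
  x≈y⇒x-y≈0 {x} {y} x≈y = trans (+-congʳ x≈y) (-‿inverseʳ y)

  -- Finite sums.

  ∑-cong : ∀ {n} {f g : Vector Carrier n} → (∀ i → f i ≈ g i) → sum f ≈ sum g
  ∑-cong {f = f} {g} = sum-cong-≋ {_} {f} {g}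

  ∑-zero : ∀ {n} {f : Vector Carrier n} → (∀ i → f i ≈ 0#) → sum f ≈ 0#
  ∑-zero {n} f≈0 = trans (∑-cong f≈0) (sum-replicate-zero n)

  ∑-scale : ∀ {n} a (f : Vector Carrier n) → sum (λ i → a * f i) ≈ a * sum f
  ∑-scale a f = sym (*-distribˡ-sum a f)

  ∑-sub : ∀ {n} (f g : Vector Carrier n) → sum (λ i → f i - g i) ≈ sum f - sum g
  ∑-sub {zero}  f g = sym (-‿inverseʳ 0#)
  ∑-sub {suc n} f g = trans (+-congˡ (∑-sub (f ∘ suc) (g ∘ suc)))
    (solve 4 (λ a b p q → (a :- b) :+ (p :- q) := (a :+ p) :- (b :+ q)) refl _ _ _ _)

  ∑-single : ∀ {n} (f : Vector Carrier n) i → (∀ j → j ≢ i → f j ≈ 0#) → sum f ≈ f i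
  ∑-single f zero    f≈0 = trans (+-congˡ (∑-zero (λ j → f≈0 (suc j) λ ()))) (+-identityʳ _)
  ∑-single f (suc i) f≈0 = trans
    (+-cong (f≈0 zero λ ()) (∑-single (f ∘ suc) i (λ j j≢i → f≈0 (suc j) (j≢i ∘ Fin.suc-injective))))
    (+-identityˡ _)

  ∑-mono-≤ : ∀ {n} {f g : Vector Carrier n} → (∀ i → f i ≤ g i) → sum f ≤ sum g
  ∑-mono-≤ {zero}  f≤g = ≤-reflexive refl
  ∑-mono-≤ {suc n} f≤g = +-mono-≤ (f≤g zero) (∑-mono-≤ (f≤g ∘ suc))

  ∑-nonneg : ∀ {n} {f : Vector Carrier n} → (∀ i → 0# ≤ f i) → 0# ≤ sum f
  ∑-nonneg {n} 0≤f = ≤-respˡ-≈ (sum-replicate-zero n) (∑-mono-≤ 0≤f)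

  ∑-nonneg≈0 : ∀ {n} {f : Vector Carrier n} → (∀ i → 0# ≤ f i) → sum f ≈ 0# → ∀ i → f i ≈ 0#
  ∑-nonneg≈0 {suc n} {f} 0≤f ∑f≈0 = λ
    { zero    → ≤-antisym
        (≤-respˡ-≈ (+-identityʳ _) (≤-respʳ-≈ ∑f≈0 (+-mono-≤ (≤-reflexive refl) 0≤∑)))
        (0≤f zero)
    ; (suc i) → ∑-nonneg≈0 (0≤f ∘ suc) (≤-antisym
        (≤-respˡ-≈ (+-identityˡ _) (≤-respʳ-≈ ∑f≈0 (+-mono-≤ (0≤f zero) (≤-reflexive refl))))
        0≤∑) i }
    where
    0≤∑ : 0# ≤ sum (f ∘ suc)
    0≤∑ = ∑-nonneg (0≤f ∘ suc)

  -- Inner products and symmetric matrices.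

  infix 8 ⟪_,_⟫
  ⟪_,_⟫ : ∀ {n} → Vector Carrier n → Vector Carrier n → Carrier
  ⟪ x , y ⟫ = sum (λ i → x i * y i)

  ⟪⟫-cong : ∀ {n} {x x′ y y′ : Vector Carrier n} →
            (∀ i → x i ≈ x′ i) → (∀ i → y i ≈ y′ i) → ⟪ x , y ⟫ ≈ ⟪ x′ , y′ ⟫
  ⟪⟫-cong x≈x′ y≈y′ = ∑-cong (λ i → *-cong (x≈x′ i) (y≈y′ i))

  ⟪⟫-comm : ∀ {n} (x y : Vector Carrier n) → ⟪ x , y ⟫ ≈ ⟪ y , x ⟫
  ⟪⟫-comm x y = ∑-cong (λ i → *-comm (x i) (y i))

  0≤⟪x,x⟫ : ∀ {n} (x : Vector Carrier n) → 0# ≤ ⟪ x , x ⟫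
  0≤⟪x,x⟫ x = ∑-nonneg (λ i → 0≤x² (x i))

  ⟪x,x⟫≈0⇒x≈0 : ∀ {n} (x : Vector Carrier n) → ⟪ x , x ⟫ ≈ 0# → ∀ i → x i ≈ 0#
  ⟪x,x⟫≈0⇒x≈0 x x²≈0 i = x²≈0⇒x≈0 (∑-nonneg≈0 (λ i → 0≤x² (x i)) x²≈0 i)

  ⟪⟫-scaleˡ : ∀ {n} a (x y : Vector Carrier n) → ⟪ (λ i → a * x i) , y ⟫ ≈ a * ⟪ x , y ⟫
  ⟪⟫-scaleˡ a x y = trans (∑-cong (λ i → *-assoc a (x i) (y i))) (∑-scale a (λ i → x i * y i))

  ⟪⟫-subˡ : ∀ {n} (x y z : Vector Carrier n) →
            ⟪ (λ i → x i - y i) , z ⟫ ≈ ⟪ x , z ⟫ - ⟪ y , z ⟫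
  ⟪⟫-subˡ x y z = trans
    (∑-cong (λ i → solve 3 (λ x y z → (x :- y) :* z := x :* z :- y :* z) refl (x i) (y i) (z i)))
    (∑-sub (λ i → x i * z i) (λ i → y i * z i))

  comb : ∀ {m n} → Vector Carrier m → (Fin m → Vector Carrier n) → Vector Carrier n
  comb a v i = sum (λ j → a j * v j i)

  ⟪comb,⟫ : ∀ {m n} (a : Vector Carrier m) (v : Fin m → Vector Carrier n) (y : Vector Carrier n) →
            ⟪ comb a v , y ⟫ ≈ sum (λ j → a j * ⟪ v j , y ⟫)
  ⟪comb,⟫ a v y = begin
    sum (λ i → sum (λ j → a j * v j i) * y i)    ≈⟨ ∑-cong (λ i → *-distribʳ-sum (y i) (λ j → a j * v j i)) ⟩
    sum (λ i → sum (λ j → a j * v j i * y i))    ≈⟨ ∑-comm (λ i j → a j * v j i * y i) ⟩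
    sum (λ j → sum (λ i → a j * v j i * y i))    ≈⟨ ∑-cong (λ j → ⟪⟫-scaleˡ (a j) (v j) y) ⟩
    sum (λ j → a j * ⟪ v j , y ⟫)                ∎

  IsSymmetric : ∀ {n} → Matrix n → Set ℓ₁
  IsSymmetric M = ∀ i j → M i j ≈ M j i

  symmetric⇒selfAdjoint : ∀ {n} {M : Matrix n} → IsSymmetric M →
                          ∀ x y → ⟪ M *ᵥ x , y ⟫ ≈ ⟪ x , M *ᵥ y ⟫
  symmetric⇒selfAdjoint {M = M} M-sym x y = begin
    sum (λ i → sum (λ j → M i j * x j) * y i)    ≈⟨ ∑-cong (λ i → *-distribʳ-sum (y i) (λ j → M i j * x j)) ⟩
    sum (λ i → sum (λ j → M i j * x j * y i))    ≈⟨ ∑-comm (λ i j → M i j * x j * y i) ⟩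
    sum (λ j → sum (λ i → M i j * x j * y i))    ≈⟨ ∑-cong (λ j → ∑-cong (λ i → entry j i)) ⟩
    sum (λ j → sum (λ i → x j * (M j i * y i)))  ≈⟨ ∑-cong (λ j → ∑-scale (x j) (λ i → M j i * y i)) ⟩
    sum (λ j → x j * sum (λ i → M j i * y i))    ∎
    where
    entry : ∀ j i → M i j * x j * y i ≈ x j * (M j i * y i)
    entry j i = trans (*-congʳ (*-congʳ (M-sym i j)))
      (solve 3 (λ m x y → m :* x :* y := x :* (m :* y)) refl _ _ _)

  *ᵥ-sub-scale : ∀ {n} (M : Matrix n) x a y i →
                 (M *ᵥ (λ j → x j - a * y j)) i ≈ (M *ᵥ x) i - a * (M *ᵥ y) i
  *ᵥ-sub-scale M x a y i = begin
    sum (λ j → M i j * (x j - a * y j))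
      ≈⟨ ∑-cong (λ j → solve 4 (λ m x a y → m :* (x :- a :* y) := m :* x :- a :* (m :* y)) refl (M i j) (x j) a (y j)) ⟩
    sum (λ j → M i j * x j - a * (M i j * y j))
      ≈⟨ ∑-sub (λ j → M i j * x j) (λ j → a * (M i j * y j)) ⟩
    (M *ᵥ x) i - sum (λ j → a * (M i j * y j))
      ≈⟨ +-congˡ (-‿cong (∑-scale a (λ j → M i j * y j))) ⟩
    (M *ᵥ x) i - a * (M *ᵥ y) i ∎

  -- Orthogonal systems: Bessel and Parseval.

  -- weight i is the inverse of the squared norm of vector i: without square
  -- roots the vectors cannot be normalised.
  record OrthogonalSystem (n m : ℕ) : Set (c ⊔ ℓ₁) where
    field
      vector     : Fin m → Vector Carrier n
      weight     : Vector Carrier m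
      normalised : ∀ i → weight i * ⟪ vector i , vector i ⟫ ≈ 1#
      orthogonal : ∀ {i j} → i ≢ j → ⟪ vector i , vector j ⟫ ≈ 0#

    weight-nonneg : ∀ i → 0# ≤ weight i
    weight-nonneg i = inverse-nonneg (normalised i) (0≤⟪x,x⟫ (vector i))

    coefficient : Vector Carrier n → Vector Carrier m
    coefficient x j = weight j * ⟪ vector j , x ⟫

    projection : Vector Carrier n → Vector Carrier n
    projection x = comb (coefficient x) vector

    residual : Vector Carrier n → Vector Carrier n
    residual x i = x i - projection x i

    residual-orthogonal : ∀ x j → ⟪ residual x , vector j ⟫ ≈ 0#
    residual-orthogonal x j = trans (⟪⟫-subˡ x (projection x) (vector j)) (x≈y⇒x-y≈0 (sym (begin
      ⟪ projection x , vector j ⟫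
        ≈⟨ ⟪comb,⟫ (coefficient x) vector (vector j) ⟩
      sum (λ i → coefficient x i * ⟪ vector i , vector j ⟫)
        ≈⟨ ∑-single _ j (λ i i≢j → trans (*-congˡ (orthogonal i≢j)) (zeroʳ _)) ⟩
      weight j * ⟪ vector j , x ⟫ * ⟪ vector j , vector j ⟫
        ≈⟨ solve 3 (λ w p q → w :* p :* q := w :* q :* p) refl _ _ _ ⟩
      weight j * ⟪ vector j , vector j ⟫ * ⟪ vector j , x ⟫
        ≈⟨ *-congʳ (normalised j) ⟩
      1# * ⟪ vector j , x ⟫
        ≈⟨ *-identityˡ _ ⟩
      ⟪ vector j , x ⟫
        ≈⟨ ⟪⟫-comm (vector j) x ⟩
      ⟪ x , vector j ⟫ ∎)))

    -- Pythagoras: the residual is orthogonal to the projection, so only the inner product with `x`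
    -- itself survives.
    ⟪residual,residual⟫ : ∀ x → ⟪ residual x , residual x ⟫ ≈
                          ⟪ x , x ⟫ - sum (λ j → weight j * (⟪ vector j , x ⟫ * ⟪ vector j , x ⟫))
    ⟪residual,residual⟫ x = begin
      ⟪ residual x , residual x ⟫
        ≈⟨ ⟪⟫-subˡ x (projection x) (residual x) ⟩
      ⟪ x , residual x ⟫ - ⟪ projection x , residual x ⟫
        ≈⟨ +-cong (⟪⟫-comm x (residual x)) (-‿cong projection⊥residual) ⟩
      ⟪ residual x , x ⟫ - 0#
        ≈⟨ x-0≈x _ ⟩
      ⟪ residual x , x ⟫
        ≈⟨ ⟪⟫-subˡ x (projection x) x ⟩
      ⟪ x , x ⟫ - ⟪ projection x , x ⟫
        ≈⟨ +-congˡ (-‿cong (trans (⟪comb,⟫ (coefficient x) vector x) (∑-cong (λ j → *-assoc (weight j) ⟪ vector j , x ⟫ ⟪ vector j , x ⟫)))) ⟩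
      ⟪ x , x ⟫ - sum (λ j → weight j * (⟪ vector j , x ⟫ * ⟪ vector j , x ⟫)) ∎
      where
      projection⊥residual : ⟪ projection x , residual x ⟫ ≈ 0#
      projection⊥residual = trans (⟪comb,⟫ (coefficient x) vector (residual x)) (∑-zero (λ j →
        trans (*-congˡ (trans (⟪⟫-comm (vector j) (residual x)) (residual-orthogonal x j))) (zeroʳ _)))

    bessel : ∀ x → sum (λ j → weight j * (⟪ vector j , x ⟫ * ⟪ vector j , x ⟫)) ≤ ⟪ x , x ⟫
    bessel x = 0≤y-x⇒x≤y (≤-respʳ-≈ (⟪residual,residual⟫ x) (0≤⟪x,x⟫ (residual x)))

  unit : ∀ {n} → Fin n → Vector Carrier n
  unit i j = if does (i Fin.≟ j) then 1# else 0#

  unit-diag : ∀ {n} (i : Fin n) → unit i i ≈ 1#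
  unit-diag i with i Fin.≟ i
  ... | yes _  = refl
  ... | no i≢i = contradiction ≡.refl i≢i

  unit-off : ∀ {n} {i j : Fin n} → i ≢ j → unit i j ≈ 0#
  unit-off {i = i} {j} i≢j with i Fin.≟ j
  ... | yes i≡j = contradiction i≡j i≢j
  ... | no _    = refl

  ⟪x,unit⟫ : ∀ {n} (x : Vector Carrier n) i → ⟪ x , unit i ⟫ ≈ x i
  ⟪x,unit⟫ x i = begin
    ⟪ x , unit i ⟫  ≈⟨ ∑-single _ i (λ j j≢i → trans (*-congˡ (unit-off (j≢i ∘ ≡.sym))) (zeroʳ _)) ⟩
    x i * unit i i  ≈⟨ *-congˡ (unit-diag i) ⟩
    x i * 1#        ≈⟨ *-identityʳ _ ⟩
    x i             ∎

  module _ {n : ℕ} (O : OrthogonalSystem n n) where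
    open OrthogonalSystem O

    -- The squared norms of the residuals of the standard basis add up to n - n.
    residual-unit : ∀ i k → residual (unit i) k ≈ 0#
    residual-unit i = ⟪x,x⟫≈0⇒x≈0 (residual (unit i))
      (∑-nonneg≈0 (λ i → 0≤⟪x,x⟫ (residual (unit i))) total i)
      where
      total : sum (λ i → ⟪ residual (unit i) , residual (unit i) ⟫) ≈ 0#
      total = begin
        sum (λ i → ⟪ residual (unit i) , residual (unit i) ⟫)
          ≈⟨ ∑-cong (λ i → trans (⟪residual,residual⟫ (unit i)) (+-cong
               (trans (⟪x,unit⟫ (unit i) i) (unit-diag i))
               (-‿cong (∑-cong (λ j → *-congˡ (*-cong (⟪x,unit⟫ (vector j) i) (⟪x,unit⟫ (vector j) i))))))) ⟩
        sum (λ i → 1# - sum (λ j → weight j * (vector j i * vector j i)))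
          ≈⟨ ∑-sub {n} (λ _ → 1#) (λ i → sum (λ j → weight j * (vector j i * vector j i))) ⟩
        sum {n} (λ _ → 1#) - sum (λ i → sum (λ j → weight j * (vector j i * vector j i)))
          -- After exchanging the sums, each vector of the system contributes its weight times its
          -- squared norm, that is 1.
          ≈⟨ x≈y⇒x-y≈0 (sym (trans (∑-comm (λ i j → weight j * (vector j i * vector j i)))
               (∑-cong (λ j → trans (∑-scale (weight j) (λ i → vector j i * vector j i)) (normalised j))))) ⟩
        0# ∎

    -- By `residual-unit` each standard basis vector equals its projection, so every coordinate of
    -- `y` can be expanded in the system.
    parseval : ∀ x y → ⟪ x , y ⟫ ≈ sum (λ j → weight j * (⟪ vector j , x ⟫ * ⟪ vector j , y ⟫))
    parseval x y = begin
      sum (λ i → x i * y i)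
        ≈⟨ ∑-cong (λ i → *-congˡ (expand i)) ⟩
      sum (λ i → x i * sum (λ j → weight j * vector j i * ⟪ vector j , y ⟫))
        ≈⟨ ∑-cong (λ i → *-distribˡ-sum (x i) (λ j → weight j * vector j i * ⟪ vector j , y ⟫)) ⟩
      sum (λ i → sum (λ j → x i * (weight j * vector j i * ⟪ vector j , y ⟫)))
        ≈⟨ ∑-comm (λ i j → x i * (weight j * vector j i * ⟪ vector j , y ⟫)) ⟩
      sum (λ j → sum (λ i → x i * (weight j * vector j i * ⟪ vector j , y ⟫)))
        ≈⟨ ∑-cong (λ j → ∑-cong (λ i →
             solve 4 (λ x w v p → x :* (w :* v :* p) := w :* p :* (v :* x)) refl (x i) (weight j) (vector j i) ⟪ vector j , y ⟫)) ⟩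
      sum (λ j → sum (λ i → weight j * ⟪ vector j , y ⟫ * (vector j i * x i)))
        ≈⟨ ∑-cong (λ j → ∑-scale (weight j * ⟪ vector j , y ⟫) (λ i → vector j i * x i)) ⟩
      sum (λ j → weight j * ⟪ vector j , y ⟫ * ⟪ vector j , x ⟫)
        ≈⟨ ∑-cong (λ j → solve 3 (λ w p q → w :* p :* q := w :* (q :* p)) refl (weight j) ⟪ vector j , y ⟫ ⟪ vector j , x ⟫) ⟩
      sum (λ j → weight j * (⟪ vector j , x ⟫ * ⟪ vector j , y ⟫)) ∎
      where
      expand : ∀ i → y i ≈ sum (λ j → weight j * vector j i * ⟪ vector j , y ⟫)
      expand i = begin
        y i                          ≈⟨ ⟪x,unit⟫ y i ⟨
        ⟪ y , unit i ⟫               ≈⟨ ⟪⟫-comm y (unit i) ⟩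
        ⟪ unit i , y ⟫               ≈⟨ ⟪⟫-cong (λ k → x-y≈0⇒x≈y (residual-unit i k)) (λ _ → refl) ⟩
        ⟪ projection (unit i) , y ⟫  ≈⟨ ⟪comb,⟫ (coefficient (unit i)) vector y ⟩
        sum (λ j → coefficient (unit i) j * ⟪ vector j , y ⟫)
          ≈⟨ ∑-cong (λ j → *-congʳ (*-congˡ (⟪x,unit⟫ (vector j) i))) ⟩
        sum (λ j → weight j * vector j i * ⟪ vector j , y ⟫) ∎

  -- Eigenvectors and Gram-Schmidt.

  IsEigenvector : ∀ {n} → Matrix n → Carrier → Vector Carrier n → Set ℓ₁
  IsEigenvector M l v = ∀ j → (M *ᵥ v) j ≈ l * v j

  independent⇒≉0 : ∀ {m n} (v : Fin (suc m) → Vector Carrier n) → LinearlyIndependent v →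
                   ¬ (∀ i → v zero i ≈ 0#)
  independent⇒≉0 v ind v₀≈0 = 1≉0 (ind (unit zero) vanish zero)
    where
    vanish : ∀ i → sum (λ j → unit zero j * v j i) ≈ 0#
    vanish i = ∑-zero {f = λ j → unit zero j * v j i} λ
      { zero    → trans (*-congˡ (v₀≈0 i)) (zeroʳ _)
      ; (suc j) → zeroˡ _ }

  -- A relation among the reduced vectors becomes one among the originals once the subtracted
  -- multiples are collected into a coefficient of `v zero`.
  independent-eliminate : ∀ {m n} (v : Fin (suc m) → Vector Carrier n) (a : Vector Carrier m) →
                          LinearlyIndependent v →
                          LinearlyIndependent (λ i k → v (suc i) k - a i * v zero k)
  independent-eliminate v a ind b b-kills j = ind ((- sum (λ i → b i * a i)) ∷ b) vanish (suc j)
    where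
    vanish : ∀ k → (- sum (λ i → b i * a i)) * v zero k + sum (λ i → b i * v (suc i) k) ≈ 0#
    vanish k = begin
      (- sum (λ i → b i * a i)) * v zero k + sum (λ i → b i * v (suc i) k)
        ≈⟨ solve 3 (λ s x p → (:- s) :* x :+ p := p :- s :* x) refl _ _ _ ⟩
      sum (λ i → b i * v (suc i) k) - sum (λ i → b i * a i) * v zero k
        ≈⟨ +-congˡ (-‿cong (*-distribʳ-sum (v zero k) (λ i → b i * a i))) ⟩
      sum (λ i → b i * v (suc i) k) - sum (λ i → b i * a i * v zero k)
        ≈⟨ ∑-sub (λ i → b i * v (suc i) k) (λ i → b i * a i * v zero k) ⟨
      sum (λ i → b i * v (suc i) k - b i * a i * v zero k)
        ≈⟨ ∑-cong (λ i → solve 4 (λ b p a q → b :* p :- b :* a :* q := b :* (p :- a :* q)) refl (b i) (v (suc i) k) (a i) (v zero k)) ⟩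
      sum (λ i → b i * (v (suc i) k - a i * v zero k))
        ≈⟨ b-kills k ⟩
      0# ∎

  module _ {n : ℕ} {M : Matrix n} (M-sym : IsSymmetric M) where

    -- Orthogonality of eigenspaces in a form free of division, so that it applies without deciding
    -- whether `k` and `l` coincide.
    eigenvectors-orthogonal : ∀ {k l u v} → IsEigenvector M k u → IsEigenvector M l v →
                              k * ⟪ u , v ⟫ ≈ l * ⟪ u , v ⟫
    eigenvectors-orthogonal {k} {l} {u} {v} Mu≈ku Mv≈lv = begin
      k * ⟪ u , v ⟫          ≈⟨ ⟪⟫-scaleˡ k u v ⟨
      ⟪ (λ i → k * u i) , v ⟫ ≈⟨ ⟪⟫-cong (λ i → sym (Mu≈ku i)) (λ _ → refl) ⟩
      ⟪ M *ᵥ u , v ⟫         ≈⟨ symmetric⇒selfAdjoint M-sym u v ⟩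
      ⟪ u , M *ᵥ v ⟫         ≈⟨ ⟪⟫-cong (λ _ → refl) Mv≈lv ⟩
      ⟪ u , (λ i → l * v i) ⟫ ≈⟨ ∑-cong (λ i → solve 3 (λ u l v → u :* (l :* v) := l :* (u :* v)) refl (u i) l (v i)) ⟩
      sum (λ i → l * (u i * v i)) ≈⟨ ∑-scale l (λ i → u i * v i) ⟩
      l * ⟪ u , v ⟫          ∎

    -- Gram–Schmidt does not mix eigenspaces: eigenvectors with different
    -- eigenvalues are already orthogonal, so the coefficient subtracted vanishes.
    eliminate-isEigenvector : ∀ {k l u v} w → IsEigenvector M k u → IsEigenvector M l v →
                              IsEigenvector M l (λ i → v i - w * ⟪ u , v ⟫ * u i)
    eliminate-isEigenvector {k} {l} {u} {v} w Mu≈ku Mv≈lv i = begin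
      (M *ᵥ (λ i → v i - w * ⟪ u , v ⟫ * u i)) i
        ≈⟨ *ᵥ-sub-scale M v (w * ⟪ u , v ⟫) u i ⟩
      (M *ᵥ v) i - w * ⟪ u , v ⟫ * (M *ᵥ u) i
        ≈⟨ +-cong (Mv≈lv i) (-‿cong (*-congˡ (Mu≈ku i))) ⟩
      l * v i - w * ⟪ u , v ⟫ * (k * u i)
        ≈⟨ solve 6 (λ l v w p k u → l :* v :- w :* p :* (k :* u) := l :* v :- w :* (k :* p) :* u) refl _ _ _ _ _ _ ⟩
      l * v i - w * (k * ⟪ u , v ⟫) * u i
        ≈⟨ +-congˡ (-‿cong (*-congʳ (*-congˡ (eigenvectors-orthogonal Mu≈ku Mv≈lv)))) ⟩
      l * v i - w * (l * ⟪ u , v ⟫) * u i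
        ≈⟨ solve 5 (λ l v w p u → l :* v :- w :* (l :* p) :* u := l :* (v :- w :* p :* u)) refl _ _ _ _ _ ⟩
      l * (v i - w * ⟪ u , v ⟫ * u i) ∎

    -- The last component is span inclusion in dual form. The recursive call needs it to see that
    -- `v₀`, orthogonal to the reduced vectors, is also orthogonal to the system built from them.
    gramSchmidt : ∀ m (l : Vector Carrier m) (v : Fin m → Vector Carrier n) →
      (∀ i → IsEigenvector M (l i) (v i)) → LinearlyIndependent v →
      ¬ ¬ (Σ[ O ∈ OrthogonalSystem n m ]
             (∀ i → IsEigenvector M (l i) (OrthogonalSystem.vector O i)) ×
             (∀ x → (∀ i → ⟪ x , v i ⟫ ≈ 0#) → ∀ i → ⟪ x , OrthogonalSystem.vector O i ⟫ ≈ 0#))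
    gramSchmidt zero l v eigen ind k = k
      ( record { vector = λ () ; weight = λ () ; normalised = λ () ; orthogonal = λ { {()} } }
      , (λ ()) , λ _ _ ())
    gramSchmidt (suc m) l v eigen ind k =
      -- The goal is empty. If every inverse of the squared norm leads to a contradiction, the norm
      -- is not apart from 0, hence equals 0, which independence forbids.
      independent⇒≉0 v ind (⟪x,x⟫≈0⇒x≈0 v₀ (¬#⇒≈ λ N#0 → step (#0⇒inverse N#0)))
      where
      v₀ = v zero

      step : ¬ (∃[ w ] w * ⟪ v₀ , v₀ ⟫ ≈ 1#)
      step (w , normal) = gramSchmidt m (l ∘ suc) v′
        (λ i → eliminate-isEigenvector w (eigen zero) (eigen (suc i)))
        (independent-eliminate v (λ i → w * ⟪ v₀ , v (suc i) ⟫) ind)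
        λ { (O , O-eigen , O-span) → k (extend O O-span
          , (λ { zero → eigen zero ; (suc i) → O-eigen i })
          , λ { x x⊥v zero    → x⊥v zero
              ; x x⊥v (suc i) → O-span x (⊥v′ x x⊥v) i }) }
        where
        v′ : Fin m → Vector Carrier n
        v′ i j = v (suc i) j - w * ⟪ v₀ , v (suc i) ⟫ * v₀ j

        ⟪⟫-v′ : ∀ x i → ⟪ x , v′ i ⟫ ≈ ⟪ x , v (suc i) ⟫ - w * ⟪ v₀ , v (suc i) ⟫ * ⟪ x , v₀ ⟫
        ⟪⟫-v′ x i = begin
          ⟪ x , v′ i ⟫
            ≈⟨ ⟪⟫-comm x (v′ i) ⟩
          ⟪ v′ i , x ⟫
            ≈⟨ ⟪⟫-subˡ (v (suc i)) (λ j → w * ⟪ v₀ , v (suc i) ⟫ * v₀ j) x ⟩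
          ⟪ v (suc i) , x ⟫ - ⟪ (λ j → w * ⟪ v₀ , v (suc i) ⟫ * v₀ j) , x ⟫
            ≈⟨ +-cong (⟪⟫-comm (v (suc i)) x)
                 (-‿cong (trans (⟪⟫-scaleˡ _ v₀ x) (*-congˡ (⟪⟫-comm v₀ x)))) ⟩
          ⟪ x , v (suc i) ⟫ - w * ⟪ v₀ , v (suc i) ⟫ * ⟪ x , v₀ ⟫ ∎

        ⊥v′ : ∀ x → (∀ i → ⟪ x , v i ⟫ ≈ 0#) → ∀ i → ⟪ x , v′ i ⟫ ≈ 0#
        ⊥v′ x x⊥v i = begin
          ⟪ x , v′ i ⟫          ≈⟨ ⟪⟫-v′ x i ⟩
          ⟪ x , v (suc i) ⟫ - w * ⟪ v₀ , v (suc i) ⟫ * ⟪ x , v₀ ⟫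
                                ≈⟨ +-cong (x⊥v (suc i)) (-‿cong (*-congˡ (x⊥v zero))) ⟩
          0# - w * ⟪ v₀ , v (suc i) ⟫ * 0#
                                ≈⟨ solve 1 (λ a → con (+ 0) :- a :* con (+ 0) := con (+ 0)) refl _ ⟩
          0#                    ∎

        v₀⊥v′ : ∀ i → ⟪ v₀ , v′ i ⟫ ≈ 0#
        v₀⊥v′ i = trans (⟪⟫-v′ v₀ i) (x≈y⇒x-y≈0 (sym (begin
          w * ⟪ v₀ , v (suc i) ⟫ * ⟪ v₀ , v₀ ⟫
            ≈⟨ solve 3 (λ w p q → w :* p :* q := w :* q :* p) refl _ _ _ ⟩
          w * ⟪ v₀ , v₀ ⟫ * ⟪ v₀ , v (suc i) ⟫
            ≈⟨ *-congʳ normal ⟩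
          1# * ⟪ v₀ , v (suc i) ⟫
            ≈⟨ *-identityˡ _ ⟩
          ⟪ v₀ , v (suc i) ⟫ ∎)))

        extend : (O : OrthogonalSystem n m) →
                 (∀ x → (∀ i → ⟪ x , v′ i ⟫ ≈ 0#) → ∀ i → ⟪ x , OrthogonalSystem.vector O i ⟫ ≈ 0#) →
                 OrthogonalSystem n (suc m)
        extend O O-span = record
          { vector     = v₀ ∷ vector
          ; weight     = w ∷ weight
          ; normalised = λ { zero → normal ; (suc i) → normalised i }
          ; orthogonal = λ
              { {zero}  {zero}  i≢j → contradiction ≡.refl i≢j
              ; {zero}  {suc j} _   → O-span v₀ v₀⊥v′ j
              ; {suc i} {zero}  _   → trans (⟪⟫-comm (vector i) v₀) (O-span v₀ v₀⊥v′ i)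
              ; {suc i} {suc j} i≢j → orthogonal (i≢j ∘ ≡.cong suc) }
          }
          where open OrthogonalSystem O

-- Ky Fan's principle.

module KyFanPrinciple {c ℓ₁ ℓ₂} (ℝ : RealNumbers c ℓ₁ ℓ₂) where
  open Spectral ℝ hiding (zero)
  open RealLinearAlgebra ℝ
  open IntegerCoefficients commutativeRing using (solve; con; _:+_; _:*_; _:-_; :-_; _:=_)
  open HeytingProperties heytingCommutativeRing using (x-0≈x)
  open SumProperties semiring
    using (sum-replicate-zero; ∑-comm; *-distribˡ-sum)
  open ≈-Reasoning setoid

  0≤fromℕ : ∀ m → 0# ≤ fromℕ m
  0≤fromℕ zero    = ≤-reflexive refl
  0≤fromℕ (suc m) = <⇒≤ (0<suc m)

  recip-inverse : ∀ m → recip (suc m) * fromℕ (suc m) ≈ 1#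
  recip-inverse m = trans (*-congˡ (sym (x-0≈x _)))
    (proj₁ (proj₂ (#⇒invertible (Equivalence.from #⇔<⊎> (inj₂ (0<suc m))))))

  ∑-const : ∀ m x → sum {m} (λ _ → x) ≈ fromℕ m * x
  ∑-const zero    x = sym (zeroˡ x)
  ∑-const (suc m) x = trans (+-cong (sym (*-identityˡ x)) (∑-const m x)) (sym (distribʳ x 1# (fromℕ m)))

  -- Termwise: a weight at most 1 cannot increase the nonnegative leading terms, and a nonnegative
  -- weight keeps the remaining terms at most 0.
  weighted-sum≤partial-sum : ∀ {n} k (k≤n : k ℕ.≤ n) (f w : Vector Carrier n) →
    (∀ i → 0# ≤ f (inject≤ i k≤n)) → (∀ j → k ℕ.≤ toℕ j → f j ≤ 0#) →
    (∀ j → 0# ≤ w j) → (∀ j → w j ≤ 1#) →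
    sum (λ j → f j * w j) ≤ sum {k} (λ i → f (inject≤ i k≤n))
  weighted-sum≤partial-sum {n} zero k≤n f w 0≤f f≤0 0≤w w≤1 =
    ≤-respʳ-≈ (sum-replicate-zero n) (∑-mono-≤ (λ j →
      ≤-respˡ-≈ (*-comm (w j) (f j)) (≤-respʳ-≈ (zeroʳ (w j)) (*-monoˡ-≤ (0≤w j) (f≤0 j ℕ.z≤n)))))
  weighted-sum≤partial-sum {suc n} (suc k) (ℕ.s≤s k≤n) f w 0≤f f≤0 0≤w w≤1 = +-mono-≤
    (≤-respʳ-≈ (*-identityʳ (f zero)) (*-monoˡ-≤ (0≤f zero) (w≤1 zero)))
    (weighted-sum≤partial-sum k k≤n (f ∘ suc) (w ∘ suc) (0≤f ∘ suc)
      (λ j k≤j → f≤0 (suc j) (ℕ.s≤s k≤j)) (0≤w ∘ suc) (w≤1 ∘ suc))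

  -- The trace of the compression of `M` to the span of the system.
  trace : ∀ {n k} → Matrix n → OrthogonalSystem n k → Carrier
  trace M O = sum (λ i → weight i * ⟪ vector i , M *ᵥ vector i ⟫)
    where open OrthogonalSystem O

  module _ {n k : ℕ} (U : OrthogonalSystem n n) (O : OrthogonalSystem n k) where
    private
      module U = OrthogonalSystem U
      module O = OrthogonalSystem O

    -- The squared cosine of the angle between the two vectors.
    share : Fin k → Fin n → Carrier
    share i j = O.weight i * (U.weight j * (⟪ U.vector j , O.vector i ⟫ * ⟪ U.vector j , O.vector i ⟫))

    -- The squared norm of the projection of the j-th normalised eigenbasis vector onto the span of
    -- `O`.
    mass : Vector Carrier n
    mass j = sum (λ i → share i j)

    mass-nonneg : ∀ j → 0# ≤ mass j
    mass-nonneg j = ∑-nonneg (λ i →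
      *-nonneg (O.weight-nonneg i) (*-nonneg (U.weight-nonneg j) (0≤x² _)))

    -- Bessel's inequality for `U.vector j` in the system `O`, divided by the squared norm.
    mass≤1 : ∀ j → mass j ≤ 1#
    mass≤1 j = ≤-respˡ-≈ (sym factor) (≤-respʳ-≈ (U.normalised j)
      (*-monoˡ-≤ (U.weight-nonneg j) (O.bessel (U.vector j))))
      where
      factor : mass j ≈ U.weight j *
               sum (λ i → O.weight i * (⟪ O.vector i , U.vector j ⟫ * ⟪ O.vector i , U.vector j ⟫))
      factor = trans
        (∑-cong (λ i → trans
          (*-congˡ (*-congˡ (*-cong (⟪⟫-comm (U.vector j) (O.vector i)) (⟪⟫-comm (U.vector j) (O.vector i)))))
          (solve 3 (λ t s p → t :* (s :* p) := s :* (t :* p)) refl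
            (O.weight i) (U.weight j) (⟪ O.vector i , U.vector j ⟫ * ⟪ O.vector i , U.vector j ⟫))))
        (∑-scale (U.weight j)
          (λ i → O.weight i * (⟪ O.vector i , U.vector j ⟫ * ⟪ O.vector i , U.vector j ⟫)))

    -- Summed the other way round, Parseval gives 1 for each of the k vectors of `O`.
    ∑-mass : sum mass ≈ fromℕ k
    ∑-mass = begin
      sum (λ j → sum (λ i → share i j))
        ≈⟨ ∑-comm share ⟨
      sum (λ i → sum (λ j → share i j))
        ≈⟨ ∑-cong (λ i → ∑-scale (O.weight i)
             (λ j → U.weight j * (⟪ U.vector j , O.vector i ⟫ * ⟪ U.vector j , O.vector i ⟫))) ⟩
      sum (λ i → O.weight i * sum (λ j → U.weight j * (⟪ U.vector j , O.vector i ⟫ * ⟪ U.vector j , O.vector i ⟫)))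
        ≈⟨ ∑-cong (λ i → trans (*-congˡ (sym (parseval U (O.vector i) (O.vector i)))) (O.normalised i)) ⟩
      sum {k} (λ _ → 1#)
        ≈⟨ trans (∑-const k 1#) (*-identityʳ _) ⟩
      fromℕ k ∎

    trace≈∑-mass : ∀ {M : Matrix n} {l : Vector Carrier n} → IsSymmetric M →
                      (∀ j → IsEigenvector M (l j) (U.vector j)) →
                      trace M O ≈ sum (λ j → l j * mass j)
    trace≈∑-mass {M} {l} M-sym eigen = begin
      sum (λ i → O.weight i * ⟪ O.vector i , M *ᵥ O.vector i ⟫)
        ≈⟨ ∑-cong (λ i → *-congˡ (parseval U (O.vector i) (M *ᵥ O.vector i))) ⟩
      sum (λ i → O.weight i * sum (λ j → U.weight j * (p i j * ⟪ U.vector j , M *ᵥ O.vector i ⟫)))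
        ≈⟨ ∑-cong (λ i → *-distribˡ-sum (O.weight i)
             (λ j → U.weight j * (p i j * ⟪ U.vector j , M *ᵥ O.vector i ⟫))) ⟩
      sum (λ i → sum (λ j → O.weight i * (U.weight j * (p i j * ⟪ U.vector j , M *ᵥ O.vector i ⟫))))
        ≈⟨ ∑-cong (λ i → ∑-cong (λ j → trans
             (*-congˡ (*-congˡ (*-congˡ (transfer i j))))
             (solve 4 (λ t s p l → t :* (s :* (p :* (l :* p))) := l :* (t :* (s :* (p :* p)))) refl
               (O.weight i) (U.weight j) (p i j) (l j)))) ⟩
      sum (λ i → sum (λ j → l j * share i j))
        ≈⟨ ∑-comm (λ i j → l j * share i j) ⟩
      sum (λ j → sum (λ i → l j * share i j))
        ≈⟨ ∑-cong (λ j → ∑-scale (l j) (λ i → share i j)) ⟩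
      sum (λ j → l j * mass j) ∎
      where
      p : Fin k → Fin n → Carrier
      p i j = ⟪ U.vector j , O.vector i ⟫

      transfer : ∀ i j → ⟪ U.vector j , M *ᵥ O.vector i ⟫ ≈ l j * p i j
      transfer i j = begin
        ⟪ U.vector j , M *ᵥ O.vector i ⟫            ≈⟨ symmetric⇒selfAdjoint M-sym (U.vector j) (O.vector i) ⟨
        ⟪ M *ᵥ U.vector j , O.vector i ⟫            ≈⟨ ⟪⟫-cong (eigen j) (λ _ → refl) ⟩
        ⟪ (λ m → l j * U.vector j m) , O.vector i ⟫ ≈⟨ ⟪⟫-scaleˡ (l j) (U.vector j) (O.vector i) ⟩
        l j * p i j                                 ∎

  -- The weights lie in [0,1] and add up to k, so ∑ lⱼ wⱼ is largest when the
  -- weight is on the k largest lⱼ; subtracting l_k first makes this termwise.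
  weighted-sum≤top-sum : ∀ {n} k (k≤n : k ℕ.≤ n) (l w : Vector Carrier n) →
    (∀ {i j} → i Fin.≤ j → l j ≤ l i) →
    (∀ j → 0# ≤ w j) → (∀ j → w j ≤ 1#) → sum w ≈ fromℕ k →
    sum (λ j → l j * w j) ≤ sum {k} (λ i → l (inject≤ i k≤n))
  -- Here no k-th value exists to be subtracted; total weight 0 makes every weight vanish.
  weighted-sum≤top-sum {n} zero k≤n l w decreasing 0≤w w≤1 ∑w≈k = ≤-reflexive
    (∑-zero (λ j → trans (*-congˡ (∑-nonneg≈0 0≤w ∑w≈k j)) (zeroʳ (l j))))
  weighted-sum≤top-sum {n} (suc k) k≤n l w decreasing 0≤w w≤1 ∑w≈k =
    ≤-respˡ-≈ (cancel _) (≤-respʳ-≈ (cancel _) (+-monoˡ-≤ (μ * fromℕ (suc k))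
      (≤-respˡ-≈ lower (≤-respʳ-≈ upper
        (weighted-sum≤partial-sum (suc k) k≤n (λ j → l j - μ) w above below 0≤w w≤1)))))
    where
    -- Indices start at 0, so position k holds the smallest of the suc k largest values.
    last = inject≤ (Fin.fromℕ k) k≤n
    μ = l last

    toℕ-last : toℕ last ≡ k
    toℕ-last = ≡.trans (Fin.toℕ-inject≤ (Fin.fromℕ k) k≤n) (Fin.toℕ-fromℕ k)

    cancel : ∀ x → x - μ * fromℕ (suc k) + μ * fromℕ (suc k) ≈ x
    cancel x = solve 2 (λ x y → x :- y :+ y := x) refl x (μ * fromℕ (suc k))

    above : ∀ i → 0# ≤ l (inject≤ i k≤n) - μ
    above i = x≤y⇒0≤y-x (decreasing
      (≡.subst₂ ℕ._≤_ (≡.sym (Fin.toℕ-inject≤ i k≤n)) (≡.sym toℕ-last) (Fin.toℕ≤pred[n] i)))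

    below : ∀ j → suc k ℕ.≤ toℕ j → l j - μ ≤ 0#
    below j k<j = ≤-respʳ-≈ (-‿inverseʳ μ) (+-monoˡ-≤ (- μ) (decreasing
      (≡.subst (ℕ._≤ toℕ j) (≡.sym toℕ-last) (ℕ.<⇒≤ k<j))))

    lower : sum (λ j → (l j - μ) * w j) ≈ sum (λ j → l j * w j) - μ * fromℕ (suc k)
    lower = begin
      sum (λ j → (l j - μ) * w j)
        ≈⟨ ∑-cong (λ j → solve 3 (λ l m w → (l :- m) :* w := l :* w :- m :* w) refl (l j) μ (w j)) ⟩
      sum (λ j → l j * w j - μ * w j)
        ≈⟨ ∑-sub (λ j → l j * w j) (λ j → μ * w j) ⟩
      sum (λ j → l j * w j) - sum (λ j → μ * w j)
        ≈⟨ +-congˡ (-‿cong (trans (∑-scale μ w) (*-congˡ ∑w≈k))) ⟩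
      sum (λ j → l j * w j) - μ * fromℕ (suc k) ∎

    upper : sum {suc k} (λ i → l (inject≤ i k≤n) - μ) ≈
            sum {suc k} (λ i → l (inject≤ i k≤n)) - μ * fromℕ (suc k)
    upper = trans (∑-sub {suc k} (λ i → l (inject≤ i k≤n)) (λ _ → μ))
      (+-congˡ (-‿cong (trans (∑-const (suc k) μ) (*-comm _ μ))))

  kyFan : ∀ {n k} {M : Matrix n} → IsSymmetric M → (Λ : Eigenvalues M) (k≤n : k ℕ.≤ n) →
          (O : OrthogonalSystem n k) → trace M O ≤ S Λ k k≤n
  kyFan {n} {k} M-sym Λ k≤n O S<trace =
    gramSchmidt M-sym n eigenvalue eigenvector isEigen independent λ { (U , U-eigen , _) →
      ≤-respˡ-≈ (sym (trace≈∑-mass U O M-sym U-eigen))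
        (weighted-sum≤top-sum k k≤n eigenvalue (mass U O) decreasing
          (mass-nonneg U O) (mass≤1 U O) (∑-mass U O))
        S<trace }
    where open Eigenvalues Λ

-- Edges inside cliques.

module _ {n : ℕ} (G : Graph n) where
  open Graph G

  ∈-neighbours⇒~ : ∀ {u v} → v ∈ neighbours u → u ~ v
  ∈-neighbours⇒~ {u} {v} v∈ with u ~? v | ≡.trans (≡.sym (Vec.lookup∘tabulate (λ w → does (u ~? w)) v)) (Vec.[]=⇒lookup v∈)
  ... | yes u~v | _ = u~v
  ... | no _    | ()

  neighbour : ∀ {r} → Regular G (suc r) → ∀ u → ∃[ v ] u ~ v
  neighbour regular u with Subset.nonempty? (neighbours u)
  ... | yes (v , v∈) = v , ∈-neighbours⇒~ v∈
  ... | no empty     = contradiction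
    (≡.trans (≡.sym (regular u)) (≡.trans (≡.cong ∣_∣ (Subset.Empty-unique empty)) (Subset.∣⊥∣≡0 n)))
    λ ()

  -- The empty set is complete, but the vertex `w` enlarges it, so it is not maximal.
  clique-nonempty : Fin n → ∀ {K} → IsClique G K → Nonempty K
  clique-nonempty w {K} (complete , maximal) with Subset.nonempty? K
  ... | yes nonempty = nonempty
  ... | no  empty    = w , maximal ⁅ w ⁆
    (λ u∈ v∈ u≢v → contradiction (≡.trans (Subset.x∈⁅y⁆⇒x≡y w u∈) (≡.sym (Subset.x∈⁅y⁆⇒x≡y w v∈))) u≢v)
    (λ x∈K → contradiction (_ , x∈K) empty)
    (Subset.x∈⁅x⁆ w)

  -- If `u` had no neighbour within the clique, the clique would be `u` alone, and any neighbour `v`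
  -- of `u` would enlarge it to a complete pair.
  clique-edge : ∀ {r} → Regular G (suc r) → Fin n → ∀ {K} → IsClique G K →
                ∃[ u ] ∃[ v ] u ∈ K × v ∈ K × u ~ v
  clique-edge regular w {K} isClique@(complete , maximal) with clique-nonempty w isClique
  ... | u , u∈K with Fin.any? (λ v → v Subset.∈? K ×-dec u ~? v)
  ...   | yes (v , v∈K , u~v) = u , v , u∈K , v∈K , u~v
  ...   | no  lonely          = contradiction
    (v , maximal ⁅u,v⁆ pair-complete K⊆⁅u,v⁆ (Subset.x∈p∪q⁺ (inj₂ (Subset.x∈⁅x⁆ v))) , u~v) lonely
    where
    v = proj₁ (neighbour regular u)
    u~v = proj₂ (neighbour regular u)
    ⁅u,v⁆ = ⁅ u ⁆ ∪ ⁅ v ⁆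

    ∈⁅u,v⁆ : ∀ {x} → x ∈ ⁅u,v⁆ → x ≡ u ⊎ x ≡ v
    ∈⁅u,v⁆ x∈ with Subset.x∈p∪q⁻ ⁅ u ⁆ ⁅ v ⁆ x∈
    ... | inj₁ x∈⁅u⁆ = inj₁ (Subset.x∈⁅y⁆⇒x≡y u x∈⁅u⁆)
    ... | inj₂ x∈⁅v⁆ = inj₂ (Subset.x∈⁅y⁆⇒x≡y v x∈⁅v⁆)

    pair-complete : Complete G ⁅u,v⁆
    pair-complete x∈ y∈ x≢y with ∈⁅u,v⁆ x∈ | ∈⁅u,v⁆ y∈
    ... | inj₁ ≡.refl | inj₁ ≡.refl = contradiction ≡.refl x≢y
    ... | inj₁ ≡.refl | inj₂ ≡.refl = u~v
    ... | inj₂ ≡.refl | inj₁ ≡.refl = ~-sym u~v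
    ... | inj₂ ≡.refl | inj₂ ≡.refl = contradiction ≡.refl x≢y

    K⊆⁅u,v⁆ : K ⊆ ⁅u,v⁆
    K⊆⁅u,v⁆ {x} x∈K with x Fin.≟ u
    ... | yes ≡.refl = Subset.x∈p∪q⁺ (inj₁ (Subset.x∈⁅x⁆ u))
    ... | no  x≢u    = contradiction (x , x∈K , complete u∈K x∈K (x≢u ∘ ≡.sym)) lonely

-- The cyclic successor.

next : ∀ {m} → Fin (suc m) → Fin (suc m)
next {m} a with suc (toℕ a) ℕ.<? suc m
... | yes 1+a<g = fromℕ< 1+a<g
... | no  _     = zero

-- With its converse this makes `CycleStep` the graph of a function, so a sum over the edges of a
-- cycle becomes a sum over their starting points.
step⇒next : ∀ {m} {a b : Fin (suc m)} → CycleStep a b → next a ≡ b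
step⇒next {m} {a} {b} step with suc (toℕ a) ℕ.<? suc m | step
... | yes 1+a<g | inj₁ 1+a≡b       = Fin.toℕ-injective (≡.trans (Fin.toℕ-fromℕ< 1+a<g) 1+a≡b)
... | yes 1+a<g | inj₂ (1+a≡g , _) = contradiction 1+a≡g (ℕ.<⇒≢ 1+a<g)
... | no  1+a≮g | inj₁ 1+a≡b       = contradiction (≡.subst (ℕ._< suc m) (≡.sym 1+a≡b) (Fin.toℕ<n b)) 1+a≮g
... | no  _     | inj₂ (_ , b≡0)   = Fin.toℕ-injective (≡.sym b≡0)

next⇒step : ∀ {m} {a b : Fin (suc m)} → next a ≡ b → CycleStep a b
next⇒step {m} {a} next≡b with suc (toℕ a) ℕ.<? suc m
next⇒step next≡b     | yes 1+a<g = inj₁ (≡.trans (≡.sym (Fin.toℕ-fromℕ< 1+a<g)) (≡.cong toℕ next≡b))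
next⇒step {a = a} ≡.refl | no 1+a≮g  = inj₂ (ℕ.≤-antisym (Fin.toℕ<n a) (ℕ.≮⇒≥ 1+a≮g) , ≡.refl)

-- Length 2 is the case to exclude: there, stepping forward and stepping back would be the same
-- edge.
next-asym : ∀ {m} {a b : Fin (suc m)} → 3 ℕ.≤ suc m → next a ≡ b → ¬ (next b ≡ a)
next-asym {m} {a} {b} 3≤g next-a≡b next-b≡a = step-asym (next⇒step next-a≡b) (next⇒step next-b≡a)
  where
  wraps-twice : ∀ {x y} → suc x ≡ y → suc y ≡ suc m → x ≡ 0 → ⊥
  wraps-twice ≡.refl ≡.refl ≡.refl = ℕ.<-irrefl ≡.refl 3≤g

  step-asym : CycleStep a b → ¬ CycleStep b a
  step-asym (inj₁ 1+a≡b)         (inj₁ 1+b≡a)         =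
    ℕ.<-asym (ℕ.≤-reflexive 1+a≡b) (ℕ.≤-reflexive 1+b≡a)
  step-asym (inj₁ 1+a≡b)         (inj₂ (1+b≡g , a≡0)) = wraps-twice 1+a≡b 1+b≡g a≡0
  step-asym (inj₂ (1+a≡g , b≡0)) (inj₁ 1+b≡a)         = wraps-twice 1+b≡a 1+a≡g b≡0
  step-asym (inj₂ (1+a≡g , b≡0)) (inj₂ (1+b≡g , a≡0)) =
    contradiction (≡.subst (3 ℕ.≤_) (≡.trans (≡.sym 1+a≡g) (≡.cong suc a≡0)) 3≤g) λ { (ℕ.s≤s ()) }

even-half : ∀ {g} → 2 ∣ g → 3 ℕ.≤ g → ∃[ h ] g ≡ suc h ℕ.+ suc h
even-half (divides zero    ≡.refl) ()
even-half (divides (suc h) ≡.refl) _ =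
  h , ≡.trans (ℕ.*-comm (suc h) 2) (≡.cong (suc h ℕ.+_) (ℕ.+-identityʳ (suc h)))

-- Test vectors and their Rayleigh quotients.

module TestVectors {c ℓ₁ ℓ₂} (ℝ : RealNumbers c ℓ₁ ℓ₂) where
  open Spectral ℝ hiding (zero)
  open RealLinearAlgebra ℝ
  open KyFanPrinciple ℝ
  open IntegerCoefficients commutativeRing using (solve; con; _:+_; _:*_; _:-_; :-_; _:=_)
  open SumProperties semiring using (∑-comm; ∑-distrib-+; *-distribˡ-sum)
  open ≈-Reasoning setoid

  embed : ∀ {m n} → (Fin m → Fin n) → Vector Carrier m → Vector Carrier n
  embed φ s = comb s (unit ∘ φ)

  -- For injective `φ`, `embed φ` is extension by zero, adjoint to restriction along `φ`; this moves
  -- inner products onto the small index set.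
  ⟪embed,⟫ : ∀ {m n} (φ : Fin m → Fin n) s (y : Vector Carrier n) → ⟪ embed φ s , y ⟫ ≈ ⟪ s , y ∘ φ ⟫
  ⟪embed,⟫ φ s y = trans (⟪comb,⟫ s (unit ∘ φ) y)
    (∑-cong (λ a → *-congˡ (trans (⟪⟫-comm (unit (φ a)) y) (⟪x,unit⟫ y (φ a)))))

  embed-on : ∀ {m n} {φ : Fin m → Fin n} → Injective _≡_ _≡_ φ → ∀ s b → embed φ s (φ b) ≈ s b
  embed-on {φ = φ} φ-inj s b = begin
    sum (λ a → s a * unit (φ a) (φ b))
      ≈⟨ ∑-single _ b (λ a a≢b → trans (*-congˡ (unit-off (a≢b ∘ φ-inj))) (zeroʳ (s a))) ⟩
    s b * unit (φ b) (φ b)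
      ≈⟨ trans (*-congˡ (unit-diag (φ b))) (*-identityʳ (s b)) ⟩
    s b ∎

  embed-off : ∀ {m n} (φ : Fin m → Fin n) s {i} → (∀ a → φ a ≢ i) → embed φ s i ≈ 0#
  embed-off φ s φ≢i = ∑-zero (λ a → trans (*-congˡ (unit-off (φ≢i a))) (zeroʳ (s a)))

  module RegularGraph {n : ℕ} (G : Graph n) {r : ℕ} (regular : Regular G r) (α : Carrier) where
    open Graph G

    Adj : Matrix n
    Adj = adjacencyMatrix G

    Adj-~ : ∀ {u v} → u ~ v → Adj u v ≈ 1#
    Adj-~ {u} {v} u~v with u ~? v
    ... | yes _   = refl
    ... | no  u≁v = contradiction u~v u≁v

    Adj-≁ : ∀ {u v} → ¬ u ~ v → Adj u v ≈ 0#
    Adj-≁ {u} {v} u≁v with u ~? v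
    ... | yes u~v = contradiction u~v u≁v
    ... | no  _   = refl

    Adj-sym : IsSymmetric Adj
    Adj-sym u v with u ~? v
    ... | yes u~v = sym (Adj-~ (~-sym u~v))
    ... | no  u≁v = sym (Adj-≁ (u≁v ∘ ~-sym))

    degreeMatrix≈ : ∀ u v → degreeMatrix G u v ≈ fromℕ r * unit u v
    degreeMatrix≈ u v with u Fin.≟ v
    ... | yes _ = trans (reflexive (≡.cong fromℕ (regular u))) (sym (*-identityʳ _))
    ... | no _  = sym (zeroʳ _)

    unit-sym : ∀ (u v : Fin n) → unit u v ≈ unit v u
    unit-sym u v with u Fin.≟ v
    ... | yes ≡.refl = sym (unit-diag u)
    ... | no  u≢v    = sym (unit-off (u≢v ∘ ≡.sym))

    A-sym : IsSymmetric (A[_] G α)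
    A-sym u v = +-cong
      (*-congˡ (trans (degreeMatrix≈ u v) (trans (*-congˡ (unit-sym u v)) (sym (degreeMatrix≈ v u)))))
      (*-congˡ (Adj-sym u v))

    ∑-indicator : ∀ {m} (f : Fin m → Bool) → sum (λ i → if f i then 1# else 0#) ≈ fromℕ ∣ tabulate f ∣
    ∑-indicator {zero}  f = refl
    ∑-indicator {suc m} f with f zero
    ... | true  = +-congˡ (∑-indicator (f ∘ suc))
    ... | false = trans (+-identityˡ _) (∑-indicator (f ∘ suc))

    ∑-Adj : ∀ u → sum (λ v → Adj u v) ≈ fromℕ r
    ∑-Adj u = trans (∑-indicator (λ v → does (u ~? v))) (reflexive (≡.cong fromℕ (regular u)))

    A-*ᵥ : ∀ x u → (A[_] G α *ᵥ x) u ≈ α * fromℕ r * x u + (1# - α) * (Adj *ᵥ x) u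
    A-*ᵥ x u = begin
      sum (λ v → (α * degreeMatrix G u v + (1# - α) * Adj u v) * x v)
        ≈⟨ ∑-cong (λ v → trans (*-congʳ (+-congʳ (*-congˡ (degreeMatrix≈ u v))))
             (solve 6 (λ a d e b p x → (a :* (d :* e) :+ b :* p) :* x := a :* d :* (x :* e) :+ b :* (p :* x)) refl
               α (fromℕ r) (unit u v) (1# - α) (Adj u v) (x v))) ⟩
      sum (λ v → α * fromℕ r * (x v * unit u v) + (1# - α) * (Adj u v * x v))
        ≈⟨ ∑-distrib-+ (λ v → α * fromℕ r * (x v * unit u v)) (λ v → (1# - α) * (Adj u v * x v)) ⟩
      sum (λ v → α * fromℕ r * (x v * unit u v)) + sum (λ v → (1# - α) * (Adj u v * x v))
        ≈⟨ +-cong (∑-scale (α * fromℕ r) (λ v → x v * unit u v)) (∑-scale (1# - α) (λ v → Adj u v * x v)) ⟩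
      α * fromℕ r * ⟪ x , unit u ⟫ + (1# - α) * (Adj *ᵥ x) u
        ≈⟨ +-congʳ (*-congˡ (⟪x,unit⟫ x u)) ⟩
      α * fromℕ r * x u + (1# - α) * (Adj *ᵥ x) u ∎

    ⟪x,Ax⟫ : ∀ x → ⟪ x , A[_] G α *ᵥ x ⟫ ≈ α * fromℕ r * ⟪ x , x ⟫ + (1# - α) * ⟪ x , Adj *ᵥ x ⟫
    ⟪x,Ax⟫ x = begin
      sum (λ u → x u * (A[_] G α *ᵥ x) u)
        ≈⟨ ∑-cong (λ u → trans (*-congˡ (A-*ᵥ x u))
             (solve 4 (λ x a b y → x :* (a :* x :+ b :* y) := a :* (x :* x) :+ b :* (x :* y)) refl
               (x u) (α * fromℕ r) (1# - α) ((Adj *ᵥ x) u))) ⟩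
      sum (λ u → α * fromℕ r * (x u * x u) + (1# - α) * (x u * (Adj *ᵥ x) u))
        ≈⟨ ∑-distrib-+ (λ u → α * fromℕ r * (x u * x u)) (λ u → (1# - α) * (x u * (Adj *ᵥ x) u)) ⟩
      sum (λ u → α * fromℕ r * (x u * x u)) + sum (λ u → (1# - α) * (x u * (Adj *ᵥ x) u))
        ≈⟨ +-cong (∑-scale (α * fromℕ r) (λ u → x u * x u)) (∑-scale (1# - α) (λ u → x u * (Adj *ᵥ x) u)) ⟩
      α * fromℕ r * ⟪ x , x ⟫ + (1# - α) * ⟪ x , Adj *ᵥ x ⟫ ∎

    kyFan-regular : ∀ {k} (Λ : Eigenvalues (A[_] G α)) (k≤n : k ℕ.≤ n) (O : OrthogonalSystem n k)
      (q : Vector Carrier k) →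
      (∀ i → OrthogonalSystem.weight O i *
             ⟪ OrthogonalSystem.vector O i , Adj *ᵥ OrthogonalSystem.vector O i ⟫ ≈ q i) →
      sum (λ i → α * fromℕ r + (1# - α) * q i) ≤ S Λ k k≤n
    kyFan-regular Λ k≤n O q quotient = ≤-respˡ-≈ (∑-cong term) (kyFan A-sym Λ k≤n O)
      where
      open OrthogonalSystem O
      term : ∀ i → weight i * ⟪ vector i , A[_] G α *ᵥ vector i ⟫ ≈ α * fromℕ r + (1# - α) * q i
      term i = begin
        weight i * ⟪ vector i , A[_] G α *ᵥ vector i ⟫
          ≈⟨ *-congˡ (⟪x,Ax⟫ (vector i)) ⟩
        weight i * (α * fromℕ r * ⟪ vector i , vector i ⟫ + (1# - α) * ⟪ vector i , Adj *ᵥ vector i ⟫)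
          ≈⟨ solve 5 (λ w a x b y → w :* (a :* x :+ b :* y) := a :* (w :* x) :+ b :* (w :* y)) refl
               (weight i) (α * fromℕ r) ⟪ vector i , vector i ⟫ (1# - α) ⟪ vector i , Adj *ᵥ vector i ⟫ ⟩
        α * fromℕ r * (weight i * ⟪ vector i , vector i ⟫) + (1# - α) * (weight i * ⟪ vector i , Adj *ᵥ vector i ⟫)
          ≈⟨ +-cong (trans (*-congˡ (normalised i)) (*-identityʳ _)) (*-congˡ (quotient i)) ⟩
        α * fromℕ r + (1# - α) * q i ∎

    -- The vector is stored by its entries on a small support, so that its quotient is computed
    -- inside the subgraph. `P` bounds the support, which yields mutual orthogonality; `entry-sum`
    -- is orthogonality to the all-ones vector.
    record TestVector (P : Fin n → Set) (q : Carrier) : Set (c ⊔ ℓ₁) where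
      field
        {size}          : ℕ
        place           : Fin size → Fin n
        place-injective : Injective _≡_ _≡_ place
        place-in        : ∀ a → P (place a)
        entry           : Vector Carrier size
        entry-sum       : sum entry ≈ 0#
        norm⁻¹          : Carrier
        normalised      : norm⁻¹ * ⟪ entry , entry ⟫ ≈ 1#
        rayleigh        : norm⁻¹ * sum (λ a → entry a * sum (λ b → entry b * Adj (place a) (place b))) ≈ q

      vector : Vector Carrier n
      vector = embed place entry

      ⟪vector,vector⟫ : ⟪ vector , vector ⟫ ≈ ⟪ entry , entry ⟫
      ⟪vector,vector⟫ = trans (⟪embed,⟫ place entry vector)
        (⟪⟫-cong (λ _ → refl) (embed-on place-injective entry))

      ⟪vector,1⟫ : ⟪ vector , (λ _ → 1#) ⟫ ≈ 0#
      ⟪vector,1⟫ = trans (⟪embed,⟫ place entry (λ _ → 1#))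
        (trans (∑-cong (λ a → *-identityʳ (entry a))) entry-sum)

      ⟪vector,Adj⟫ : ⟪ vector , Adj *ᵥ vector ⟫ ≈
                     sum (λ a → entry a * sum (λ b → entry b * Adj (place a) (place b)))
      ⟪vector,Adj⟫ = trans (⟪embed,⟫ place entry (Adj *ᵥ vector))
        (∑-cong (λ a → *-congˡ (trans (⟪⟫-comm (Adj (place a)) vector) (⟪embed,⟫ place entry (Adj (place a))))))

    test-bound : ∀ {k} {P : Fin k → Fin n → Set} {q : Vector Carrier k} →
      (∀ {i j} → i ≢ j → ∀ v → P i v → ¬ P j v) → (∀ i → TestVector (P i) (q i)) →
      (Λ : Eigenvalues (A[_] G α)) (k<n : suc k ℕ.≤ n) →
      (α * fromℕ r + (1# - α) * fromℕ r) + sum (λ i → α * fromℕ r + (1# - α) * q i) ≤ S Λ (suc k) k<n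
    test-bound {k} {P} {q} P-disjoint test Λ k<n = kyFan-regular Λ k<n system (fromℕ r ∷ q)
      λ { zero → ones-rayleigh ; (suc i) → trans (*-congˡ (T.⟪vector,Adj⟫ i)) (T.rayleigh i) }
      where
      module T i = TestVector (test i)

      ones : Vector Carrier n
      ones _ = 1#

      -- By convention `recip zero` is `0#`; `k<n` makes n positive, so this is a true inverse.
      recip-n : recip n * fromℕ n ≈ 1#
      recip-n = inverse k<n
        where
        inverse : ∀ {m} → suc k ℕ.≤ m → recip m * fromℕ m ≈ 1#
        inverse {suc m} _ = recip-inverse m

      ones-rayleigh : recip n * ⟪ ones , Adj *ᵥ ones ⟫ ≈ fromℕ r
      ones-rayleigh = begin
        recip n * sum (λ u → 1# * sum (λ v → Adj u v * 1#))
          ≈⟨ *-congˡ (∑-cong (λ u → trans (*-identityˡ _)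
               (trans (∑-cong (λ v → *-identityʳ (Adj u v))) (∑-Adj u)))) ⟩
        recip n * sum {n} (λ _ → fromℕ r)
          ≈⟨ *-congˡ (∑-const n (fromℕ r)) ⟩
        recip n * (fromℕ n * fromℕ r)
          ≈⟨ trans (sym (*-assoc _ _ _)) (trans (*-congʳ recip-n) (*-identityˡ _)) ⟩
        fromℕ r ∎

      disjoint-orthogonal : ∀ {i j} → i ≢ j → ⟪ T.vector i , T.vector j ⟫ ≈ 0#
      disjoint-orthogonal {i} {j} i≢j = trans (⟪embed,⟫ (T.place i) (T.entry i) (T.vector j))
        (∑-zero (λ a → trans
          (*-congˡ (embed-off (T.place j) (T.entry j) (λ b b≡a →
            P-disjoint i≢j (T.place i a) (T.place-in i a) (≡.subst (P j) b≡a (T.place-in j b)))))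
          (zeroʳ (T.entry i a))))

      system : OrthogonalSystem n (suc k)
      system = record
        { vector     = ones ∷ T.vector
        ; weight     = recip n ∷ T.norm⁻¹
        ; normalised = λ
            { zero    → trans (*-congˡ (trans (∑-cong {n} (λ _ → *-identityʳ 1#))
                          (trans (∑-const n 1#) (*-identityʳ _)))) recip-n
            ; (suc i) → trans (*-congˡ (T.⟪vector,vector⟫ i)) (T.normalised i) }
        ; orthogonal = λ
            { {zero}  {zero}  i≢j → contradiction ≡.refl i≢j
            ; {zero}  {suc j} _   → trans (⟪⟫-comm ones (T.vector j)) (T.⟪vector,1⟫ j)
            ; {suc i} {zero}  _   → T.⟪vector,1⟫ i
            ; {suc i} {suc j} i≢j → disjoint-orthogonal (i≢j ∘ ≡.cong suc) }
        }

    edge-test : ∀ {P : Fin n → Set} {u v} → P u → P v → u ~ v → TestVector P (- 1#)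
    edge-test {P} {u} {v} Pu Pv u~v = record
      { place           = place
      ; place-injective = injective
      ; place-in        = λ { zero → Pu ; (suc zero) → Pv }
      ; entry           = entry
      ; entry-sum       = solve 0 (con (+ 1) :+ (:- con (+ 1) :+ con (+ 0)) := con (+ 0)) refl
      ; norm⁻¹          = recip 2
      -- The numerals copy how `sum` and `fromℕ 2` unfold, with a final 0, so that the solver's
      -- terms match definitionally.
      ; normalised      = trans (*-congˡ (solve 0
          (con (+ 1) :* con (+ 1) :+ (:- con (+ 1) :* :- con (+ 1) :+ con (+ 0)) :=
           con (+ 1) :+ (con (+ 1) :+ con (+ 0))) refl)) (recip-inverse 1)
      ; rayleigh        = begin
          recip 2 * sum (λ a → entry a * sum (λ b → entry b * Adj (place a) (place b)))
            ≈⟨ *-congˡ (∑-cong (λ a → *-congˡ {entry a} (∑-cong (λ b → *-congˡ {entry b} (adjacency a b))))) ⟩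
          recip 2 * sum (λ a → entry a * sum (λ b → entry b * swap a b))
            -- Both orientations of the edge contribute - 1, to be divided by the squared norm 2.
            ≈⟨ solve 1 (λ h →
                 h :* (con (+ 1) :* (con (+ 1) :* con (+ 0) :+ (:- con (+ 1) :* con (+ 1) :+ con (+ 0))) :+
                      (:- con (+ 1) :* (con (+ 1) :* con (+ 1) :+ (:- con (+ 1) :* con (+ 0) :+ con (+ 0))) :+ con (+ 0)))
                 := :- (h :* (con (+ 1) :+ (con (+ 1) :+ con (+ 0))))) refl (recip 2) ⟩
          - (recip 2 * fromℕ 2)
            ≈⟨ -‿cong (recip-inverse 1) ⟩
          - 1# ∎
      }
      where
      place : Fin 2 → Fin n
      place = u ∷ v ∷ λ ()

      entry : Vector Carrier 2
      entry = 1# ∷ (- 1#) ∷ λ ()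

      swap : Fin 2 → Fin 2 → Carrier
      swap zero       = 0# ∷ 1# ∷ λ ()
      swap (suc zero) = 1# ∷ 0# ∷ λ ()

      adjacency : ∀ a b → Adj (place a) (place b) ≈ swap a b
      adjacency zero       zero       = Adj-≁ ~-irrefl
      adjacency zero       (suc zero) = Adj-~ u~v
      adjacency (suc zero) zero       = Adj-~ (~-sym u~v)
      adjacency (suc zero) (suc zero) = Adj-≁ ~-irrefl

      injective : Injective _≡_ _≡_ place
      injective {zero}     {zero}     _ = ≡.refl
      injective {zero}     {suc zero} ≡.refl = contradiction u~v ~-irrefl
      injective {suc zero} {zero}     ≡.refl = contradiction u~v ~-irrefl
      injective {suc zero} {suc zero} _ = ≡.refl

    unit-system : ∀ {k} → k ℕ.≤ n → OrthogonalSystem n k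
    unit-system k≤n = record
      { vector     = λ i → unit (inject≤ i k≤n)
      ; weight     = λ _ → 1#
      ; normalised = λ i → trans (*-identityˡ _)
          (trans (⟪x,unit⟫ (unit (inject≤ i k≤n)) (inject≤ i k≤n)) (unit-diag (inject≤ i k≤n)))
      ; orthogonal = λ {i} {j} i≢j → trans (⟪x,unit⟫ (unit (inject≤ i k≤n)) (inject≤ j k≤n))
          (unit-off (i≢j ∘ Fin.inject≤-injective k≤n k≤n i j))
      }

    -- The adjacency matrix has zero diagonal, so standard basis vectors have quotient 0.
    diagonal-bound : ∀ {k} (Λ : Eigenvalues (A[_] G α)) (k≤n : k ℕ.≤ n) →
                     fromℕ k * (α * fromℕ r) ≤ S Λ k k≤n
    diagonal-bound {k} Λ k≤n = ≤-respˡ-≈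
      (trans (∑-cong {k} (λ _ → trans (+-congˡ (zeroʳ _)) (+-identityʳ _))) (∑-const k (α * fromℕ r)))
      (kyFan-regular Λ k≤n (unit-system k≤n) (λ _ → 0#) (λ i → trans (*-identityˡ _)
        (trans (⟪⟫-comm (unit (inject≤ i k≤n)) (Adj *ᵥ unit (inject≤ i k≤n)))
        (trans (⟪x,unit⟫ (Adj *ᵥ unit (inject≤ i k≤n)) (inject≤ i k≤n))
        (trans (⟪x,unit⟫ (Adj (inject≤ i k≤n)) (inject≤ i k≤n)) (Adj-≁ ~-irrefl))))))

    -- The boolean test computes: `sign zero` is constantly - 1, and a successor on both arguments
    -- cancels. The recursion in `∑-sign` relies on this.
    sign : ℕ → ℕ → Carrier
    sign h i = if i ℕ.<ᵇ h then 1# else - 1#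

    sign-< : ∀ {h i} → i ℕ.< h → sign h i ≈ 1#
    sign-< {h} {i} i<h with i ℕ.<ᵇ h | ℕ.<⇒<ᵇ i<h
    ... | true | _ = refl

    sign-≥ : ∀ {h i} → h ℕ.≤ i → sign h i ≈ - 1#
    sign-≥ {h} {i} h≤i with i ℕ.<ᵇ h | ℕ.<ᵇ⇒< i h
    ... | true  | i<h = contradiction (i<h tt) (ℕ.≤⇒≯ h≤i)
    ... | false | _   = refl

    sign² : ∀ h i → sign h i * sign h i ≈ 1#
    sign² h i with i ℕ.<ᵇ h
    ... | true  = *-identityˡ 1#
    ... | false = solve 0 (:- con (+ 1) :* :- con (+ 1) := con (+ 1)) refl

    ∑-sign : ∀ h m → sum {h ℕ.+ m} (λ a → sign h (toℕ a)) ≈ fromℕ h - fromℕ m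
    ∑-sign zero    m = trans (∑-const m (- 1#))
      (solve 1 (λ m → m :* :- con (+ 1) := con (+ 0) :- m) refl (fromℕ m))
    ∑-sign (suc h) m = trans (+-congˡ (∑-sign h m)) (sym (+-assoc 1# (fromℕ h) (- fromℕ m)))

    -- On a cycle of length 2(h + 1) the vector that is 1 on the first half and - 1
    -- on the second changes sign along two edges only: at mid and at last.
    module _ (h : ℕ) where
      private
        g : ℕ
        g = suc h ℕ.+ suc h

        two : Carrier
        two = 1# + 1#

      mid : Fin g
      mid = Fin.fromℕ h Fin.↑ˡ suc h

      last : Fin g
      last = suc h Fin.↑ʳ Fin.fromℕ h

      toℕ-mid : toℕ mid ≡ h
      toℕ-mid = ≡.trans (Fin.toℕ-↑ˡ (Fin.fromℕ h) (suc h)) (Fin.toℕ-fromℕ h)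

      toℕ-last : toℕ last ≡ suc h ℕ.+ h
      toℕ-last = ≡.trans (Fin.toℕ-↑ʳ (suc h) (Fin.fromℕ h)) (≡.cong (suc h ℕ.+_) (Fin.toℕ-fromℕ h))

      1+last≡g : suc (toℕ last) ≡ g
      1+last≡g = ≡.trans (≡.cong suc toℕ-last) (≡.sym (ℕ.+-suc (suc h) h))

      halves : Vector Carrier g
      halves a = sign (suc h) (toℕ a)

      -- The product is 1 along an edge that keeps the sign and - 1 otherwise. Written with
      -- indicators of the two exceptional edges, it can be summed linearly.
      halves-step : ∀ a → halves a * halves (next a) ≈ 1# - two * unit mid a - two * unit last a
      halves-step a with next⇒step {a = a} ≡.refl
      ... | inj₂ (1+a≡g , next≡0) = trans
        (*-cong (sign-≥ 1+h≤a) (trans (reflexive (≡.cong (sign (suc h)) next≡0)) (sign-< {suc h} (ℕ.s≤s ℕ.z≤n))))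
        (trans
          (solve 0 (:- con (+ 1) :* con (+ 1) :=
                    con (+ 1) :- con (+ 2) :* con (+ 0) :- con (+ 2) :* con (+ 1)) refl)
          (sym (+-cong (+-congˡ (-‿cong (*-congˡ (unit-off mid≢a)))) (-‿cong (*-congˡ at-last)))))
        where
        last≡a : last ≡ a
        last≡a = Fin.toℕ-injective (ℕ.suc-injective (≡.trans 1+last≡g (≡.sym 1+a≡g)))

        1+h≤a : suc h ℕ.≤ toℕ a
        1+h≤a = ≡.subst (suc h ℕ.≤_) (≡.trans (≡.sym toℕ-last) (≡.cong toℕ last≡a)) (ℕ.m≤m+n (suc h) h)

        mid≢a : mid ≢ a
        mid≢a mid≡a = ℕ.<⇒≢ 1+h≤a (≡.trans (≡.sym toℕ-mid) (≡.cong toℕ mid≡a))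

        at-last : unit last a ≈ 1#
        at-last = trans (reflexive (≡.cong (unit last) (≡.sym last≡a))) (unit-diag last)
      ... | inj₁ 1+a≡next = trans (*-congˡ (reflexive (≡.cong (sign (suc h)) (≡.sym 1+a≡next)))) (inside (ℕ.<-cmp (toℕ a) h))
        where
        last≢a : last ≢ a
        last≢a last≡a = ℕ.<⇒≢ (Fin.toℕ<n (next a))
          (≡.trans (≡.sym 1+a≡next) (≡.trans (≡.cong (suc ∘ toℕ) (≡.sym last≡a)) 1+last≡g))

        off-mid : toℕ a ≢ h → unit mid a ≈ 0#
        off-mid a≢h = unit-off (λ mid≡a → a≢h (≡.trans (≡.cong toℕ (≡.sym mid≡a)) toℕ-mid))

        inside : _ → sign (suc h) (toℕ a) * sign (suc h) (suc (toℕ a)) ≈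
                     1# - two * unit mid a - two * unit last a
        inside (tri< a<h a≢h _) = trans
          (*-cong (sign-< (ℕ.m<n⇒m<1+n a<h)) (sign-< (ℕ.s≤s a<h)))
          (trans
            (solve 0 (con (+ 1) :* con (+ 1) :=
                      con (+ 1) :- con (+ 2) :* con (+ 0) :- con (+ 2) :* con (+ 0)) refl)
            (sym (+-cong (+-congˡ (-‿cong (*-congˡ (off-mid a≢h)))) (-‿cong (*-congˡ (unit-off last≢a))))))
        inside (tri≈ _ a≡h _) = trans
          (*-cong (sign-< (ℕ.s≤s (ℕ.≤-reflexive a≡h))) (sign-≥ (ℕ.s≤s (ℕ.≤-reflexive (≡.sym a≡h)))))
          (trans
            (solve 0 (con (+ 1) :* :- con (+ 1) :=
                      con (+ 1) :- con (+ 2) :* con (+ 1) :- con (+ 2) :* con (+ 0)) refl)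
            (sym (+-cong (+-congˡ (-‿cong (*-congˡ at-mid))) (-‿cong (*-congˡ (unit-off last≢a))))))
          where
          at-mid : unit mid a ≈ 1#
          at-mid = trans
            (reflexive (≡.cong (unit mid) (Fin.toℕ-injective (≡.trans a≡h (≡.sym toℕ-mid)))))
            (unit-diag mid)
        inside (tri> _ a≢h h<a) = trans
          (*-cong (sign-≥ h<a) (sign-≥ (ℕ.m≤n⇒m≤1+n h<a)))
          (trans
            (solve 0 (:- con (+ 1) :* :- con (+ 1) :=
                      con (+ 1) :- con (+ 2) :* con (+ 0) :- con (+ 2) :* con (+ 0)) refl)
            (sym (+-cong (+-congˡ (-‿cong (*-congˡ (off-mid a≢h)))) (-‿cong (*-congˡ (unit-off last≢a))))))

      ∑-halves-step : sum (λ a → halves a * halves (next a)) ≈ fromℕ g - fromℕ 4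
      ∑-halves-step = begin
        sum (λ a → halves a * halves (next a))
          ≈⟨ ∑-cong halves-step ⟩
        sum (λ a → 1# - two * unit mid a - two * unit last a)
          ≈⟨ ∑-sub (λ a → 1# - two * unit mid a) (λ a → two * unit last a) ⟩
        sum (λ a → 1# - two * unit mid a) - ⟪ (λ _ → two) , unit last ⟫
          ≈⟨ +-cong (∑-sub (λ _ → 1#) (λ a → two * unit mid a)) (-‿cong (⟪x,unit⟫ (λ _ → two) last)) ⟩
        sum {g} (λ _ → 1#) - ⟪ (λ _ → two) , unit mid ⟫ - two
          ≈⟨ +-congʳ (+-cong (∑-const g 1#) (-‿cong (⟪x,unit⟫ (λ _ → two) mid))) ⟩
        fromℕ g * 1# - two - two
          ≈⟨ solve 1 (λ g → g :* con (+ 1) :- con (+ 2) :- con (+ 2) := g :- (con (+ 1) :+ (con (+ 1) :+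
               (con (+ 1) :+ (con (+ 1) :+ con (+ 0)))))) refl (fromℕ g) ⟩
        fromℕ g - fromℕ 4 ∎

      halves-test : ∀ {P : Fin n → Set} (C : InducedCycle G g) → (∀ a → P (InducedCycle.vertex C a)) →
                    TestVector P (fromℕ 2 * (1# - fromℕ 4 /ℕ g))
      halves-test C vertex-in = record
        { place           = vertex
        ; place-injective = injective
        ; place-in        = vertex-in
        ; entry           = halves
        ; entry-sum       = trans (∑-sign (suc h) (suc h)) (-‿inverseʳ _)
        ; norm⁻¹          = recip g
        ; normalised      = trans (*-congˡ (trans (∑-cong {g} (λ a → sign² (suc h) (toℕ a)))
                              (trans (∑-const g 1#) (*-identityʳ _)))) (recip-inverse (h ℕ.+ suc h))
        ; rayleigh        = begin
            recip g * sum (λ a → halves a * sum (λ b → halves b * Adj (vertex a) (vertex b)))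
              ≈⟨ *-congˡ adjacency-form ⟩
            recip g * ((fromℕ g - fromℕ 4) + (fromℕ g - fromℕ 4))
              ≈⟨ solve 3 (λ w g f → w :* ((g :- f) :+ (g :- f)) :=
                   (con (+ 1) :+ (con (+ 1) :+ con (+ 0))) :* (w :* g :- f :* w)) refl
                   (recip g) (fromℕ g) (fromℕ 4) ⟩
            fromℕ 2 * (recip g * fromℕ g - fromℕ 4 * recip g)
              ≈⟨ *-congˡ (+-congʳ (recip-inverse (h ℕ.+ suc h))) ⟩
            fromℕ 2 * (1# - fromℕ 4 /ℕ g) ∎
        }
        where
        open InducedCycle C

        -- As the cycle is induced, adjacency means stepping forward or backward; by `next-asym`
        -- never both, so the two indicators do not add up to 2.
        adjacency : ∀ a b → Adj (vertex a) (vertex b) ≈ unit (next a) b + unit (next b) a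
        adjacency a b with next a Fin.≟ b | next b Fin.≟ a
        ... | yes a→b | yes b→a = contradiction b→a (next-asym 3≤g a→b)
        ... | yes a→b | no  _   = trans
          (Adj-~ (Equivalence.from (induced a b) (inj₁ (next⇒step a→b)))) (sym (+-identityʳ 1#))
        ... | no  _   | yes b→a = trans
          (Adj-~ (Equivalence.from (induced a b) (inj₂ (next⇒step b→a)))) (sym (+-identityˡ 1#))
        ... | no  a↛b | no  b↛a = trans
          (Adj-≁ ([ a↛b ∘ step⇒next , b↛a ∘ step⇒next ]′ ∘ Equivalence.to (induced a b)))
          (sym (+-identityˡ 0#))

        forward : sum (λ a → halves a * sum (λ b → halves b * unit (next a) b)) ≈ fromℕ g - fromℕ 4
        forward = trans (∑-cong (λ a → *-congˡ {halves a} (⟪x,unit⟫ halves (next a)))) ∑-halves-step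

        backward : sum (λ a → halves a * sum (λ b → halves b * unit (next b) a)) ≈ fromℕ g - fromℕ 4
        backward = begin
          sum (λ a → halves a * sum (λ b → halves b * unit (next b) a))
            ≈⟨ ∑-cong (λ a → *-distribˡ-sum (halves a) (λ b → halves b * unit (next b) a)) ⟩
          sum (λ a → sum (λ b → halves a * (halves b * unit (next b) a)))
            ≈⟨ ∑-comm (λ a b → halves a * (halves b * unit (next b) a)) ⟩
          sum (λ b → sum (λ a → halves a * (halves b * unit (next b) a)))
            ≈⟨ ∑-cong (λ b → ∑-cong (λ a →
                 solve 3 (λ x y z → x :* (y :* z) := y :* (x :* z)) refl
                   (halves a) (halves b) (unit (next b) a))) ⟩
          sum (λ b → sum (λ a → halves b * (halves a * unit (next b) a)))
            ≈⟨ ∑-cong (λ b → ∑-scale (halves b) (λ a → halves a * unit (next b) a)) ⟩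
          sum (λ b → halves b * sum (λ a → halves a * unit (next b) a))
            -- The exchanged sum is that of `forward` up to renaming of the bound indices.
            ≈⟨ forward ⟩
          fromℕ g - fromℕ 4 ∎

        adjacency-form : sum (λ a → halves a * sum (λ b → halves b * Adj (vertex a) (vertex b))) ≈
                         (fromℕ g - fromℕ 4) + (fromℕ g - fromℕ 4)
        adjacency-form = begin
          sum (λ a → halves a * sum (λ b → halves b * Adj (vertex a) (vertex b)))
            ≈⟨ ∑-cong (λ a → *-congˡ {halves a} (∑-cong (λ b →
                 trans (*-congˡ (adjacency a b)) (distribˡ (halves b) (unit (next a) b) (unit (next b) a))))) ⟩
          sum (λ a → halves a * sum (λ b → halves b * unit (next a) b + halves b * unit (next b) a))
            ≈⟨ ∑-cong (λ a → trans
                 (*-congˡ {halves a} (∑-distrib-+ (λ b → halves b * unit (next a) b) (λ b → halves b * unit (next b) a)))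
                 (distribˡ (halves a) (sum (λ b → halves b * unit (next a) b)) (sum (λ b → halves b * unit (next b) a)))) ⟩
          sum (λ a → halves a * sum (λ b → halves b * unit (next a) b) +
                     halves a * sum (λ b → halves b * unit (next b) a))
            ≈⟨ ∑-distrib-+ (λ a → halves a * sum (λ b → halves b * unit (next a) b))
                           (λ a → halves a * sum (λ b → halves b * unit (next b) a)) ⟩
          sum (λ a → halves a * sum (λ b → halves b * unit (next a) b)) +
          sum (λ a → halves a * sum (λ b → halves b * unit (next b) a))
            ≈⟨ +-cong forward backward ⟩
          (fromℕ g - fromℕ 4) + (fromℕ g - fromℕ 4) ∎

    cycle-test : ∀ {P : Fin n → Set} {g} → 2 ∣ g → (C : InducedCycle G g) →
                 (∀ a → P (InducedCycle.vertex C a)) → TestVector P (fromℕ 2 * (1# - fromℕ 4 /ℕ g))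
    cycle-test 2∣g C vertex-in with even-half 2∣g (InducedCycle.3≤g C)
    ... | h , ≡.refl = halves-test h C vertex-in

    -- With r = 0 the claimed bound for suc k eigenvalues is - (1 - α) k, at most 0 because α ≤ 1,
    -- and `diagonal-bound` supplies 0.
    edgeless-cliques-bound : r ≡ 0 → α ≤ 1# → (Λ : Eigenvalues (A[_] G α)) →
      ∀ {k} (k<n : suc k ℕ.≤ n) →
      α * fromℕ (suc k) * fromℕ r + (1# - α) * (fromℕ r - fromℕ (suc k) + 1#) ≤ S Λ (suc k) k<n
    edgeless-cliques-bound ≡.refl α≤1 Λ {k} k<n = ≤-trans
      (0≤y-x⇒x≤y (≤-respʳ-≈
        (solve 2 (λ a k → (con (+ 1) :- a) :* k :=
            (con (+ 1) :+ k) :* (a :* con (+ 0)) :-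
            (a :* (con (+ 1) :+ k) :* con (+ 0) :+ (con (+ 1) :- a) :* (con (+ 0) :- (con (+ 1) :+ k) :+ con (+ 1))))
          refl α (fromℕ k))
        (*-nonneg (x≤y⇒0≤y-x α≤1) (0≤fromℕ k))))
      (diagonal-bound Λ k<n)

    cliques-bound : ∀ {r′} → r ≡ suc r′ → ∀ {t} → DisjointCliques G t → (Λ : Eigenvalues (A[_] G α)) →
      ∀ {k} → k ℕ.≤ t → (k<n : suc k ℕ.≤ n) →
      α * fromℕ (suc k) * fromℕ r + (1# - α) * (fromℕ r - fromℕ (suc k) + 1#) ≤ S Λ (suc k) k<n
    cliques-bound ≡.refl D Λ {k} k≤t k<n = ≤-respˡ-≈
      (trans (+-congˡ (∑-const k (α * fromℕ r + (1# - α) * (- 1#))))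
        (solve 3 (λ a r k →
            (a :* r :+ (con (+ 1) :- a) :* r) :+ k :* (a :* r :+ (con (+ 1) :- a) :* :- con (+ 1)) :=
            a :* (con (+ 1) :+ k) :* r :+ (con (+ 1) :- a) :* (r :- (con (+ 1) :+ k) :+ con (+ 1)))
          refl α (fromℕ r) (fromℕ k)))
      (test-bound {P = λ i v → v ∈ clique (inject≤ i k≤t)} {q = λ _ → - 1#}
        (λ i≢j v v∈Kᵢ v∈Kⱼ → disjoint (i≢j ∘ Fin.inject≤-injective k≤t k≤t _ _)
          (v , Subset.x∈p∩q⁺ (v∈Kᵢ , v∈Kⱼ)))
        test Λ k<n)
      where
      open DisjointCliques D
      test : ∀ i → TestVector (λ v → v ∈ clique (inject≤ i k≤t)) (- 1#)
      -- Some vertex is required to rule out an empty clique; `k<n` guarantees that vertex 0 exists.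
      test i with clique-edge G regular (inject≤ zero k<n) (isClique (inject≤ i k≤t))
      ... | u , v , u∈K , v∈K , u~v = edge-test u∈K v∈K u~v

    cycles-bound : ∀ {m} {g : Fin m → ℕ} → DisjointEvenInducedCycles G g → (Λ : Eigenvalues (A[_] G α)) →
      ∀ {k} (k≤m : k ℕ.≤ m) (k<n : suc k ℕ.≤ n) →
      (α * fromℕ (suc k) + 1# - α) * fromℕ r
        + fromℕ 2 * (1# - α) * sum {k} (λ i → 1# - fromℕ 4 /ℕ g (inject≤ i k≤m))
      ≤ S Λ (suc k) k<n
    cycles-bound {g = g} D Λ {k} k≤m k<n = ≤-respˡ-≈ total
      (test-bound {P = λ i v → ∃[ a ] InducedCycle.vertex (cycle (inject≤ i k≤m)) a ≡ v}
        (λ { i≢j v (a , a↦v) (b , b↦v) → disjoint (i≢j ∘ Fin.inject≤-injective k≤m k≤m _ _) a b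
               (≡.trans a↦v (≡.sym b↦v)) })
        (λ i → cycle-test (even (inject≤ i k≤m)) (cycle (inject≤ i k≤m)) (λ a → a , ≡.refl))
        Λ k<n)
      where
      open DisjointEvenInducedCycles D
      x : Vector Carrier k
      x i = 1# - fromℕ 4 /ℕ g (inject≤ i k≤m)

      total : (α * fromℕ r + (1# - α) * fromℕ r) + sum (λ i → α * fromℕ r + (1# - α) * (fromℕ 2 * x i)) ≈
              (α * fromℕ (suc k) + 1# - α) * fromℕ r + fromℕ 2 * (1# - α) * sum x
      total = begin
        (α * fromℕ r + (1# - α) * fromℕ r) + sum (λ i → α * fromℕ r + (1# - α) * (fromℕ 2 * x i))
          ≈⟨ +-congˡ (∑-distrib-+ (λ _ → α * fromℕ r) (λ i → (1# - α) * (fromℕ 2 * x i))) ⟩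
        (α * fromℕ r + (1# - α) * fromℕ r) + (sum {k} (λ _ → α * fromℕ r) + sum (λ i → (1# - α) * (fromℕ 2 * x i)))
          ≈⟨ +-congˡ (+-cong (∑-const k (α * fromℕ r))
               (trans (∑-scale (1# - α) (λ i → fromℕ 2 * x i)) (*-congˡ (∑-scale (fromℕ 2) x)))) ⟩
        (α * fromℕ r + (1# - α) * fromℕ r) + (fromℕ k * (α * fromℕ r) + (1# - α) * (fromℕ 2 * sum x))
          ≈⟨ solve 5 (λ a r k d y →
               (a :* r :+ (con (+ 1) :- a) :* r) :+ (k :* (a :* r) :+ (con (+ 1) :- a) :* (d :* y)) :=
               (a :* (con (+ 1) :+ k) :+ con (+ 1) :- a) :* r :+ d :* (con (+ 1) :- a) :* y)
               refl α (fromℕ r) (fromℕ k) (fromℕ 2) (sum x) ⟩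
        (α * fromℕ (suc k) + 1# - α) * fromℕ r + fromℕ 2 * (1# - α) * sum x ∎

theorem5p2 : ∀ {c ℓ₁ ℓ₂} (ℝ : RealNumbers c ℓ₁ ℓ₂) →
    let open Spectral ℝ in
    ∀ {n} (G : Graph n) (r : ℕ) → Regular G r →
    (α : Carrier) → 0# ≤ α → α ≤ 1# →
    (Λ : Eigenvalues (A[_] G α)) →
    (∀ t → DisjointCliques G t →
    ∀ k → 1 ℕ.≤ k → k ℕ.≤ suc t → (k≤n : k ℕ.≤ n) →
    α * fromℕ k * fromℕ r + (1# - α) * (fromℕ r - fromℕ k + 1#) ≤ S Λ k k≤n)
    ×
    (∀ m (g : Fin m → ℕ) → DisjointEvenInducedCycles G g →
    ∀ k → 1 ℕ.≤ k → (k≤1+m : k ℕ.≤ suc m) → (k≤n : k ℕ.≤ n) →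
    (α * fromℕ k + 1# - α) * fromℕ r
    + fromℕ 2 * (1# - α)
    * sum {k ∸ 1} (λ i → 1# - fromℕ 4 /ℕ g (inject≤ i (∸-monoˡ-≤ 1 k≤1+m)))
    ≤ S Λ k k≤n)
theorem5p2 ℝ G r regular α 0≤α α≤1 Λ = cliques r regular , cycles
  where
  open Spectral ℝ using (fromℕ; _*_; _+_; _-_; 1#; _≤_; S)
  open TestVectors ℝ

  cliques : ∀ r → Regular G r → ∀ t → DisjointCliques G t →
    ∀ k → 1 ℕ.≤ k → k ℕ.≤ suc t → (k≤n : k ℕ.≤ _) →
    α * fromℕ k * fromℕ r + (1# - α) * (fromℕ r - fromℕ k + 1#) ≤ S Λ k k≤n
  cliques zero    regular t D (suc k) _ _           k≤n =
    RegularGraph.edgeless-cliques-bound G regular α ≡.refl α≤1 Λ k≤n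
  cliques (suc r) regular t D (suc k) _ (ℕ.s≤s k≤t) k≤n =
    RegularGraph.cliques-bound G regular α ≡.refl D Λ k≤t k≤n

  cycles : ∀ m (g : Fin m → ℕ) → DisjointEvenInducedCycles G g → ∀ k → 1 ℕ.≤ k → _
  -- The proof of k ≤ m is the one written in the statement, so both sums select the cycles by the
  -- same indices.
  cycles m g D (suc k) _ k≤1+m k≤n =
    RegularGraph.cycles-bound G regular α D Λ (∸-monoˡ-≤ 1 k≤1+m) k≤n
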